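{- Let $q=2^m$ with $m$ a positive integer, let $n$ be a positive integer, let $k$ and $l$ be nonnegative integers, and let $a\in\mathbb F_{q^n}^*$. Put $d=\gcd(l-1,m)$. Then $ax^{2^lq^k}+x\mathrm{Tr}(x)$ is a permutation polynomial of $\mathbb F_{q^n}$ if and only if $n$ is odd, $\gcd\big(2^{l+mk}-1,(q^n-1)/(q-1)\big)=1$, and $a\in\mathbb F_q^*$ with $a^{(q-1)/(2^d-1)}\ne1$.
   Context: $\mathrm{Tr}$ is the trace map of $\mathbb F_{q^n}/\mathbb F_q$, so $\mathrm{Tr}(x)=\sum_{i=0}^{n-1}x^{q^i}$. A permutation polynomial of $\mathbb F_{q^n}$ is a polynomial over $\mathbb F_{q^n}$ whose induced map on $\mathbb F_{q^n}$ is a bijection. Greatest common divisors are of integers, taken nonnegative, with $\gcd(0,N)=N$ for $N>0$. -}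

module Defs where

open import Algebra.Bundles using (CommutativeRing)
open import Algebra.Definitions using (Invertible)
open import Algebra.Morphism.Structures using (module RingMorphisms)
open import Data.Fin.Base using (Fin)
open import Data.List.Base using (List; []; _∷_; map; replicate; foldr; applyUpTo; _++_)
open import Data.Nat.Base as ℕ using (ℕ; NonZero; ≢-nonZero; ≢-nonZero⁻¹; _∸_; _<_; s≤s; z≤n)
open import Data.Nat.GCD using (gcd; gcd[m,n]≢0)
open import Data.Nat.Properties using (m>n⇒m∸n≢0; ^-monoʳ-<; n≢0⇒n>0)
open import Data.Product.Base using (∃; _×_)
open import Data.Sum.Base using (inj₂)
open import Function.Bundles using (Inverse)
open import Function.Definitions using (Bijective)
open import Level using (Level; _⊔_; suc)
open import Relation.Binary.PropositionalEquality using (setoid)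
open import Relation.Nullary.Negation using (¬_)

private
  variable
    c ℓ c′ ℓ′ : Level

-- The N elements are counted up to _≈_.
record FiniteField c ℓ (N : ℕ) : Set (suc (c ⊔ ℓ)) where
  field
    commutativeRing : CommutativeRing c ℓ

  open CommutativeRing commutativeRing public hiding (setoid)

  field
    1≉0         : ¬ 1# ≈ 0#
    invertible  : ∀ x → ¬ x ≈ 0# → Invertible _≈_ 1# _*_ x
    enumeration : Inverse (CommutativeRing.setoid commutativeRing) (setoid (Fin N))

  open import Algebra.Properties.Semiring.Exp semiring public using (_^_)

-- Exhibits L as an extension of K; K is identified with the image of ι.
record Embedding {q Q : ℕ} (K : FiniteField c ℓ q) (L : FiniteField c′ ℓ′ Q)
       : Set (c ⊔ ℓ ⊔ c′ ⊔ ℓ′) where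
  private
    module K = FiniteField K
    module L = FiniteField L

  field
    ι                  : K.Carrier → L.Carrier
    isRingMonomorphism : RingMorphisms.IsRingMonomorphism K.rawRing L.rawRing ι

  _∈K : L.Carrier → Set (c ⊔ ℓ′)
  x ∈K = ∃ λ y → ι y L.≈ x

  _∈K* : L.Carrier → Set (c ⊔ ℓ′)
  x ∈K* = x ∈K × ¬ x L.≈ L.0#

module Polynomials {N : ℕ} (L : FiniteField c ℓ N) where
  open FiniteField L

  -- Coefficients in order of increasing degree; trailing zeros are allowed.
  Polynomial : Set c
  Polynomial = List Carrier

  infixl 6 _⊕_
  infixl 7 _⊗_

  _⊕_ : Polynomial → Polynomial → Polynomial
  []      ⊕ g       = g
  (a ∷ f) ⊕ []      = a ∷ f
  (a ∷ f) ⊕ (b ∷ g) = (a + b) ∷ (f ⊕ g)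

  _⊗_ : Polynomial → Polynomial → Polynomial
  []      ⊗ g = []
  (a ∷ f) ⊗ g = map (a *_) g ⊕ (0# ∷ (f ⊗ g))

  C : Carrier → Polynomial
  C a = a ∷ []

  X^_ : ℕ → Polynomial
  X^ e = replicate e 0# ++ C 1#

  X : Polynomial
  X = X^ 1

  eval : Polynomial → Carrier → Carrier
  eval []      x = 0#
  eval (a ∷ f) x = a + x * eval f x

  IsPermutationPolynomial : Polynomial → Set (c ⊔ ℓ)
  IsPermutationPolynomial f = Bijective _≈_ _≈_ (eval f)

  -- The trace from the field with qⁿ elements to the field with q elements,
  -- as the polynomial X + X^q + ⋯ + X^(q^(n-1)).
  Tr : (q n : ℕ) → Polynomial
  Tr q n = foldr _⊕_ [] (applyUpTo (λ i → X^ (q ℕ.^ i)) n)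

2^m∸1≢0 : ∀ m .{{_ : NonZero m}} → NonZero (2 ℕ.^ m ∸ 1)
2^m∸1≢0 m = ≢-nonZero (m>n⇒m∸n≢0 (^-monoʳ-< 2 (s≤s (s≤s z≤n)) (n≢0⇒n>0 (≢-nonZero⁻¹ m))))

2^gcd∸1≢0 : ∀ i m .{{_ : NonZero m}} → NonZero (2 ℕ.^ gcd i m ∸ 1)
2^gcd∸1≢0 i m = 2^m∸1≢0 (gcd i m) {{≢-nonZero (gcd[m,n]≢0 i m (inj₂ (≢-nonZero⁻¹ m)))}}

module Submission where

-- Write σ x = x^(2^l q^k) and f x = a σ x + x Tr x. For a ∈ K one has
-- Tr (f x) = g (Tr x) with g t = a t^(2^l) + t², so f permutes L iff the additive
-- map g is injective on K and f is injective on the fibres of Tr. Hilbert 90 for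
-- t ↦ t^(2^|l-1|) on K says when g has a nonzero root, and f is injective on the
-- fibres iff no y ≠ 0 of trace 0 satisfies σ y = κ y with κ ∈ K*. For n even, y = 1
-- is such an element. For n odd, a solution y ∉ K of σ y = κ y yields the solution
-- y + Tr y of trace 0, while y ∈ K* has trace y ≠ 0; and every solution lies in K
-- iff the coprimality condition holds.
--
-- If a ∉ K, put b = a⁻¹. Some x₁ has Tr x₁ = Tr (b x₁) = 1, so b f(x₁) has trace 0
-- and equals σ x₂ for some x₂ of trace 0; then f x₁ = f x₂, and f is not injective.

open import Defs
open import Algebra.Bundles using (CommutativeMonoid; module CommutativeRing)
open import Algebra.Morphism.Structures using (module RingMorphisms)
open import Data.Fin.Base using (Fin; zero; suc; punchIn; punchOut; toℕ)
import Data.Fin.Properties as Fin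
open import Data.List.Base using ([]; _∷_; map; foldr; applyUpTo)
open import Data.Nat.Base as ℕ using (ℕ; zero; suc; NonZero; _∸_; _<_; _≤_; z≤n; s≤s; _/_; _%_)
open import Data.Nat.Divisibility using (_∣_; divides; m∣m*n; ∣m∣n⇒∣m+n; m%n≡0⇒n∣m)
import Data.Nat.DivMod as ℕ
open import Data.Nat.GCD using (gcd; gcd-GCD; gcd[m,n]∣m; gcd[m,n]∣n; module Bézout)
import Data.Nat.Properties as ℕ
open import Data.Nat.Tactic.RingSolver using (solve-∀)
open import Data.Product.Base using (∃; _×_; _,_; proj₁; proj₂)
open import Function.Base using (_∘_)
open import Function.Bundles using (Inverse; _⇔_; mk⇔; module Equivalence)
open import Function.Construct.Composition using () renaming (inverse to _⨾_)
open import Function.Construct.Symmetry using () renaming (inverse to symmetric)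
open import Function.Definitions using (Congruent; Injective; Surjective)
open import Level using (_⊔_)
open import Relation.Binary.PropositionalEquality as ≡ using (_≡_)
open import Relation.Nullary.Decidable using (Dec; yes; no; map′)
open import Relation.Nullary.Negation using (¬_; contradiction)

-- Let a ∈ K*. If Tr y = 0 then f(x + y) = f x + a σ y + y Tr x, so a collision inside a fibre means
-- σ y = (Tr x / a) y; since Tr maps onto K, every κ ∈ K occurs as Tr x / a. For y ≠ 0 the ratio σ y
-- / y is y^(2^r - 1) with r = l + mk. It lies in K* iff u = y^(q-1) satisfies u^(2^r - 1) = 1,
-- whereas y ∈ K iff u = 1. Every such u satisfies u^M = 1 for M = (q^n - 1)/(q - 1); this is the
-- origin of the gcd with M. The number 2^d - 1 is gcd(2^|l-1| - 1, q - 1). Hence a^((q-1)/(2^d-1))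
-- = 1 says that a is a (2^d - 1)-th power in K, equivalently a (2^|l-1| - 1)-th power. Inside L,
-- membership in K is expressed by x^q = x. Only Hilbert 90 is applied to K itself, because its
-- exponent depends on the order of the field.

-- Divisibility, Bézout coefficients, finite sets.

b∸1∣b^k∸1 : ∀ b k .{{_ : NonZero b}} → b ∸ 1 ∣ b ℕ.^ k ∸ 1
b∸1∣b^k∸1 (suc b) zero    = divides 0 ≡.refl
b∸1∣b^k∸1 (suc b) (suc k) =
  ≡.subst (b ∣_) (≡.sym (ℕ.+-∸-comm (b ℕ.* suc b ℕ.^ k) (ℕ.>-nonZero⁻¹ _ {{ℕ.m^n≢0 (suc b) k}})))
    (∣m∣n⇒∣m+n (b∸1∣b^k∸1 (suc b) k) (m∣m*n (suc b ℕ.^ k)))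

2^d∸1∣2^m∸1 : ∀ {d m} → d ∣ m → 2 ℕ.^ d ∸ 1 ∣ 2 ℕ.^ m ∸ 1
2^d∸1∣2^m∸1 {d} (divides k ≡.refl) = ≡.subst (λ e → 2 ℕ.^ d ∸ 1 ∣ e ∸ 1)
  (≡.trans (ℕ.^-*-assoc 2 d k) (≡.cong (2 ℕ.^_) (ℕ.*-comm d k)))
  (b∸1∣b^k∸1 (2 ℕ.^ d) k {{ℕ.m^n≢0 2 d}})

suc[b^k∸1]≡b^k : ∀ b k .{{_ : NonZero b}} → suc (b ℕ.^ k ∸ 1) ≡ b ℕ.^ k
suc[b^k∸1]≡b^k b k = ℕ.suc-pred (b ℕ.^ k) {{ℕ.m^n≢0 b k}}

-- With multiples of j on both sides, one equation covers both cases of Bézout.Identity.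
bézout : ∀ i j .{{_ : NonZero j}} → ∃ λ x → ∃ λ y → ∃ λ z → gcd i j ℕ.+ y ℕ.* j ≡ x ℕ.* i ℕ.+ z ℕ.* j
bézout i (suc j) with Bézout.identity (gcd-GCD i (suc j))
... | Bézout.+- x y eq = x , y , 0 , ≡.trans eq (≡.sym (ℕ.+-identityʳ _))
... | Bézout.-+ x y eq = x ℕ.* j , x ℕ.* i , y , (begin
  gcd i (suc j) ℕ.+ x ℕ.* i ℕ.* suc j             ≡⟨ ≡.cong (gcd i (suc j) ℕ.+_) (ℕ.*-suc (x ℕ.* i) j) ⟩
  gcd i (suc j) ℕ.+ (x ℕ.* i ℕ.+ x ℕ.* i ℕ.* j)   ≡⟨ ℕ.+-assoc (gcd i (suc j)) _ _ ⟨
  gcd i (suc j) ℕ.+ x ℕ.* i ℕ.+ x ℕ.* i ℕ.* j     ≡⟨ ≡.cong₂ ℕ._+_ eq (swap x i j) ⟩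
  y ℕ.* suc j ℕ.+ x ℕ.* j ℕ.* i                   ≡⟨ ℕ.+-comm (y ℕ.* suc j) _ ⟩
  x ℕ.* j ℕ.* i ℕ.+ y ℕ.* suc j                   ∎)
  where
  open ≡.≡-Reasoning
  swap : ∀ x i j → x ℕ.* i ℕ.* j ≡ x ℕ.* j ℕ.* i
  swap = solve-∀

-- Moves the factor `e` from `s` over to `E`; with `e * E` the order of the multiplicative group it
-- exhibits `s * E` as a multiple of that order.
*-transfer : ∀ {e E k n s} → s ≡ k ℕ.* e → e ℕ.* E ≡ n → s ℕ.* E ≡ n ℕ.* k
*-transfer {e} {E} {k} ≡.refl ≡.refl = ≡.trans (ℕ.*-assoc k e E) (ℕ.*-comm k (e ℕ.* E))

-- Pigeonhole: punching out a missed value would give an injection of `Fin (suc n)` into `Fin n`.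
Fin-injective⇒surjective : ∀ {n} {f : Fin n → Fin n} → Injective _≡_ _≡_ f → ∀ y → ∃ λ x → f x ≡ y
Fin-injective⇒surjective {suc n} {f} inj y with Fin.any? (λ x → f x Fin.≟ y)
... | yes hit = hit
... | no miss = contradiction (Fin.injective⇒≤ {f = g} g-injective) (ℕ.<⇒≱ (ℕ.n<1+n n))
  where
  y≢f : ∀ x → ¬ y ≡ f x
  y≢f x y≡fx = miss (x , ≡.sym y≡fx)
  g : Fin (suc n) → Fin n
  g x = punchOut (y≢f x)
  g-injective : Injective _≡_ _≡_ g
  g-injective {i} {j} eq = inj (Fin.punchOut-injective (y≢f i) (y≢f j) eq)

module _ {a b} (M : CommutativeMonoid a b) where
  open CommutativeMonoid M
  open import Algebra.Properties.CommutativeMonoid.Sum M using (sum; sum-cong-≋; sum-replicate-zero; sum-remove)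

  sum-single : ∀ {n} (t : Fin n → Carrier) i → (∀ j → ¬ i ≡ j → t j ≈ ε) → sum t ≈ t i
  sum-single {suc n} t i rest = trans (sum-remove {i = i} t) (trans
    (∙-congˡ (trans (sum-cong-≋ (λ j → rest (punchIn i j) (Fin.punchInᵢ≢i i j ∘ ≡.sym)))
                    (sum-replicate-zero n)))
    (identityʳ (t i)))

-- Finite fields: Fermat's theorem, bounds on roots, existence of e-th roots.

module FiniteFieldProperties {c ℓ N} (F : FiniteField c ℓ N) where
  open FiniteField F hiding (zero)
  open CommutativeRing commutativeRing using (setoid)
  open Inverse enumeration public using ()
    renaming (to to index; from to element; to-cong to index-cong; from-cong to element-cong;
              strictlyInverseˡ to index-element; strictlyInverseʳ to element-index)
  open import Algebra.Properties.Semiring.Exp semiring public hiding (_^_)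
  open import Algebra.Properties.CommutativeSemiring.Exp commutativeSemiring public using (^-distrib-*)
  open import Algebra.Properties.Ring ring public using (+-cancelˡ; +-cancelʳ)
  open import Algebra.Properties.Semiring.Mult semiring using () renaming (_×_ to _·_)
  import Algebra.Properties.CommutativeMonoid.Sum as Sum
  open import Algebra.Solver.Ring.NaturalCoefficients.Default commutativeSemiring
  open import Relation.Binary.Reasoning.Setoid setoid

  infix 4 _≈?_

  index-injective : ∀ {x y} → index x ≡ index y → x ≈ y
  index-injective {x} {y} eq = trans (sym (element-index x)) (trans (element-cong eq) (element-index y))

  element-injective : ∀ {i j} → element i ≈ element j → i ≡ j
  element-injective {i} {j} eq = ≡.trans (≡.sym (index-element i)) (≡.trans (index-cong eq) (index-element j))

  _≈?_ : ∀ x y → Dec (x ≈ y)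
  x ≈? y = map′ index-injective index-cong (index x Fin.≟ index y)

  *-cancelˡ-≉0 : ∀ {x y z} → x ≉ 0# → x * y ≈ x * z → y ≈ z
  *-cancelˡ-≉0 {x} {y} {z} x≉0 xy≈xz with invertible x x≉0
  ... | x⁻¹ , x⁻¹x≈1 , _ = begin
    y              ≈⟨ sym (*-identityˡ y) ⟩
    1# * y         ≈⟨ *-congʳ (sym x⁻¹x≈1) ⟩
    x⁻¹ * x * y    ≈⟨ *-assoc _ _ _ ⟩
    x⁻¹ * (x * y)  ≈⟨ *-congˡ xy≈xz ⟩
    x⁻¹ * (x * z)  ≈⟨ sym (*-assoc _ _ _) ⟩
    x⁻¹ * x * z    ≈⟨ *-congʳ x⁻¹x≈1 ⟩
    1# * z         ≈⟨ *-identityˡ z ⟩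
    z              ∎

  *-cancelʳ-≉0 : ∀ {x y z} → x ≉ 0# → y * x ≈ z * x → y ≈ z
  *-cancelʳ-≉0 x≉0 eq = *-cancelˡ-≉0 x≉0 (trans (*-comm _ _) (trans eq (*-comm _ _)))

  *-≉0 : ∀ {x y} → x ≉ 0# → y ≉ 0# → x * y ≉ 0#
  *-≉0 x≉0 y≉0 xy≈0 = y≉0 (*-cancelˡ-≉0 x≉0 (trans xy≈0 (sym (zeroʳ _))))

  ^-≉0 : ∀ {x} k → x ≉ 0# → x ^ k ≉ 0#
  ^-≉0 zero    x≉0 = 1≉0
  ^-≉0 (suc k) x≉0 = *-≉0 x≉0 (^-≉0 k x≉0)

  1^k≈1 : ∀ k → 1# ^ k ≈ 1#
  1^k≈1 zero    = refl
  1^k≈1 (suc k) = trans (*-identityˡ _) (1^k≈1 k)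

  factor-≉0ˡ : ∀ {x y} → x * y ≉ 0# → x ≉ 0#
  factor-≉0ˡ xy≉0 x≈0 = xy≉0 (trans (*-congʳ x≈0) (zeroˡ _))

  factor-≉0ʳ : ∀ {x y} → x * y ≉ 0# → y ≉ 0#
  factor-≉0ʳ xy≉0 y≈0 = xy≉0 (trans (*-congˡ y≈0) (zeroʳ _))

  injective⇒surjective : ∀ {f} → Congruent _≈_ _≈_ f → Injective _≈_ _≈_ f → Surjective _≈_ _≈_ f
  injective⇒surjective {f} f-cong f-inj y
    with i , eq ← Fin-injective⇒surjective {f = index ∘ f ∘ element}
                    (element-injective ∘ f-inj ∘ index-injective) (index y)
    = element i , λ z≈ → trans (f-cong z≈) (index-injective eq)

  module _ {a b} (M : CommutativeMonoid a b) where
    private module M = CommutativeMonoid M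
    open Sum M using (sum; sum-cong-≋; sum-permute)

    sum-reindex : ∀ {f : Carrier → M.Carrier} → Congruent _≈_ M._≈_ f → (φ : Inverse setoid setoid) →
                  sum (f ∘ element) M.≈ sum (f ∘ Inverse.to φ ∘ element)
    sum-reindex {f} f-cong φ = M.trans
      (sum-permute (f ∘ element) (symmetric enumeration ⨾ (φ ⨾ enumeration)))
      (sum-cong-≋ (λ i → f-cong (element-index (Inverse.to φ (element i)))))

  -- The translation by 1 permutes the field, so the sum of all elements equals itself plus N·1.
  N·1≈0 : N · 1# ≈ 0#
  N·1≈0 = +-cancelʳ (sum element) _ _ (begin
    N · 1# + sum element                  ≈⟨ +-congʳ (sym (sum-replicate N)) ⟩
    sum {N} (λ _ → 1#) + sum element      ≈⟨ sym (∑-distrib-+ (λ _ → 1#) element) ⟩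
    sum (λ i → 1# + element i)            ≈⟨ sym (sum-reindex +-commutativeMonoid (λ eq → eq) shift) ⟩
    sum element                           ≈⟨ sym (+-identityˡ _) ⟩
    0# + sum element                      ∎)
    where
    open Sum +-commutativeMonoid using (sum; sum-replicate; ∑-distrib-+)
    shift : Inverse setoid setoid
    shift = record
      { to = 1# +_
      ; from = - 1# +_
      ; to-cong = +-congˡ
      ; from-cong = +-congˡ
      ; inverse = (λ {x} eq → trans (+-congˡ eq) (cancel (-‿inverseʳ 1#) x))
                , (λ {x} eq → trans (+-congˡ eq) (cancel (-‿inverseˡ 1#) x))
      }
      where
      cancel : ∀ {u v} → u + v ≈ 0# → ∀ x → u + (v + x) ≈ x
      cancel u+v≈0 x = trans (sym (+-assoc _ _ _)) (trans (+-congʳ u+v≈0) (+-identityˡ x))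

  private
    ifZero : Carrier → Carrier → Carrier → Carrier
    ifZero y s t with y ≈? 0#
    ... | yes _ = s
    ... | no  _ = t

    ifZero-yes : ∀ {y s t} → y ≈ 0# → ifZero y s t ≈ s
    ifZero-yes {y} y≈0 with y ≈? 0#
    ... | yes _   = refl
    ... | no  y≉0 = contradiction y≈0 y≉0

    ifZero-no : ∀ {y s t} → y ≉ 0# → ifZero y s t ≈ t
    ifZero-no {y} y≉0 with y ≈? 0#
    ... | yes y≈0 = contradiction y≈0 y≉0
    ... | no  _   = refl

  -- Multiplication by x ≠ 0 permutes the nonzero elements, which leaves their product unchanged.
  -- The products run over all N indices, so 0 is masked: `u` replaces it by 1, `v` contributes x at
  -- the nonzero elements only, and `δ` supplies the one missing factor x at 0.
  x^N≈x : ∀ x → x ^ N ≈ x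
  x^N≈x x with x ≈? 0#
  -- An element of `Fin n` excludes the exponent 0, where the power would be 1.
  ... | yes x≈0 = helper (index 0#)
    where
    helper : ∀ {n} → Fin n → x ^ n ≈ x
    helper {suc n} _ = trans (trans (*-congʳ x≈0) (zeroˡ _)) (sym x≈0)
  ... | no x≉0 = begin
    x ^ N                      ≈⟨ sym (sum-replicate N) ⟩
    product {N} (λ _ → x)      ≈⟨ sum-cong-≋ (λ i → sym (vδ (element i))) ⟩
    product (λ i → v (element i) * δ (element i))  ≈⟨ ∑-distrib-+ (v ∘ element) (δ ∘ element) ⟩
    product (v ∘ element) * product (δ ∘ element)  ≈⟨ *-cong ∏v≈1 ∏δ≈x ⟩
    1# * x                     ≈⟨ *-identityˡ x ⟩
    x                          ∎
    where
    open Sum *-commutativeMonoid using (sum-replicate; sum-cong-≋; ∑-distrib-+) renaming (sum to product)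
    u v δ : Carrier → Carrier
    u y = ifZero y 1# y
    v y = ifZero y 1# x
    δ y = ifZero y x 1#

    vδ : ∀ y → v y * δ y ≈ x
    vδ y with y ≈? 0#
    ... | yes _ = *-identityˡ x
    ... | no  _ = *-identityʳ x

    u≉0 : ∀ y → u y ≉ 0#
    u≉0 y with y ≈? 0#
    ... | yes _   = 1≉0
    ... | no  y≉0 = y≉0

    u-cong : Congruent _≈_ _≈_ u
    u-cong {y} {z} y≈z with y ≈? 0#
    ... | yes y≈0 = sym (ifZero-yes (trans (sym y≈z) y≈0))
    ... | no  y≉0 = trans y≈z (sym (ifZero-no (y≉0 ∘ trans y≈z)))

    u-scale : ∀ y → u (x * y) ≈ v y * u y
    u-scale y with y ≈? 0#
    ... | yes y≈0 = trans (ifZero-yes (trans (*-congˡ y≈0) (zeroʳ x))) (sym (*-identityˡ 1#))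
    ... | no  y≉0 = ifZero-no (*-≉0 x≉0 y≉0)

    product-≉0 : ∀ {n} (t : Fin n → Carrier) → (∀ i → t i ≉ 0#) → product t ≉ 0#
    product-≉0 {zero}  t t≉0 = 1≉0
    product-≉0 {suc n} t t≉0 = *-≉0 (t≉0 zero) (product-≉0 (t ∘ suc) (t≉0 ∘ suc))

    scale : Inverse setoid setoid
    scale with x⁻¹ , x⁻¹x≈1 , xx⁻¹≈1 ← invertible x x≉0 = record
      { to = x *_
      ; from = x⁻¹ *_
      ; to-cong = *-congˡ
      ; from-cong = *-congˡ
      ; inverse = (λ {y} eq → trans (*-congˡ eq) (cancel xx⁻¹≈1 y))
                , (λ {y} eq → trans (*-congˡ eq) (cancel x⁻¹x≈1 y))
      }
      where
      cancel : ∀ {u v} → u * v ≈ 1# → ∀ x → u * (v * x) ≈ x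
      cancel uv≈1 x = trans (sym (*-assoc _ _ _)) (trans (*-congʳ uv≈1) (*-identityˡ x))

    ∏v≈1 : product (v ∘ element) ≈ 1#
    ∏v≈1 = *-cancelʳ-≉0 (product-≉0 (u ∘ element) (u≉0 ∘ element)) (begin
      product (v ∘ element) * product (u ∘ element)  ≈⟨ sym (∑-distrib-+ (v ∘ element) (u ∘ element)) ⟩
      product (λ i → v (element i) * u (element i))  ≈⟨ sum-cong-≋ (λ i → sym (u-scale (element i))) ⟩
      product (λ i → u (x * element i))              ≈⟨ sym (sum-reindex *-commutativeMonoid u-cong scale) ⟩
      product (u ∘ element)                          ≈⟨ sym (*-identityˡ _) ⟩
      1# * product (u ∘ element)                     ∎)

    ∏δ≈x : product (δ ∘ element) ≈ x
    ∏δ≈x = trans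
      (sum-single *-commutativeMonoid (δ ∘ element) (index 0#)
        (λ j 0≢j → ifZero-no (λ ej≈0 → 0≢j (≡.trans (index-cong (sym ej≈0)) (index-element j)))))
      (ifZero-yes (element-index 0#))

  x^[N∸1]≈1 : ∀ {x} → x ≉ 0# → x ^ (N ∸ 1) ≈ 1#
  x^[N∸1]≈1 {x} x≉0 = helper (index 0#) (x^N≈x x)
    where
    helper : ∀ {n} → Fin n → x ^ n ≈ x → x ^ (n ∸ 1) ≈ 1#
    helper {suc n} _ eq = *-cancelˡ-≉0 x≉0 (trans eq (sym (*-identityʳ x)))

  x^k≈0⇒x≈0 : ∀ {x} k → x ^ k ≈ 0# → x ≈ 0#
  x^k≈0⇒x≈0 {x} k x^k≈0 with x ≈? 0#
  ... | yes x≈0 = x≈0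
  ... | no  x≉0 = contradiction x^k≈0 (^-≉0 k x≉0)

  x^k≉0⇒x≉0 : ∀ {x} k .{{_ : NonZero k}} → x ^ k ≉ 0# → x ≉ 0#
  x^k≉0⇒x≉0 (suc k) = factor-≉0ˡ

  ^-swap : ∀ x i j → (x ^ i) ^ j ≈ (x ^ j) ^ i
  ^-swap x i j = trans (^-assocʳ x i j) (trans (^-congʳ x (ℕ.*-comm i j)) (sym (^-assocʳ x j i)))

  x^k≈x⇒x^[k∸1]≈1 : ∀ {x} k → x ≉ 0# → x ^ k ≈ x → x ^ (k ∸ 1) ≈ 1#
  x^k≈x⇒x^[k∸1]≈1 zero    x≉0 eq = refl
  x^k≈x⇒x^[k∸1]≈1 (suc k) x≉0 eq = *-cancelˡ-≉0 x≉0 (trans eq (sym (*-identityʳ _)))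

  x^[k∸1]≈1⇒x^k≈x : ∀ {x} k .{{_ : NonZero k}} → x ^ (k ∸ 1) ≈ 1# → x ^ k ≈ x
  x^[k∸1]≈1⇒x^k≈x (suc k) eq = trans (*-congˡ eq) (*-identityʳ _)

  x^i≈1⇒x^[i*j]≈1 : ∀ {x} i j → x ^ i ≈ 1# → x ^ (i ℕ.* j) ≈ 1#
  x^i≈1⇒x^[i*j]≈1 {x} i j eq = trans (sym (^-assocʳ x i j)) (trans (^-congˡ j eq) (1^k≈1 j))

  coprime-exponents : ∀ {x} i j .{{_ : NonZero j}} → gcd i j ≡ 1 → x ^ i ≈ 1# → x ^ j ≈ 1# → x ≈ 1#
  coprime-exponents {x} i j gcd≡1 x^i≈1 x^j≈1
    with u , v , w , eq ← bézout i j = begin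
    x                                  ≈⟨ sym (trans (*-identityʳ _) (*-identityʳ x)) ⟩
    x ^ 1 * 1#                         ≈⟨ *-congˡ (sym (multiple j v x^j≈1)) ⟩
    x ^ 1 * x ^ (v ℕ.* j)              ≈⟨ sym (^-homo-* x 1 (v ℕ.* j)) ⟩
    x ^ (1 ℕ.+ v ℕ.* j)                ≡⟨ ≡.cong (x ^_) (≡.trans (≡.cong (ℕ._+ v ℕ.* j) (≡.sym gcd≡1)) eq) ⟩
    x ^ (u ℕ.* i ℕ.+ w ℕ.* j)          ≈⟨ ^-homo-* x (u ℕ.* i) (w ℕ.* j) ⟩
    x ^ (u ℕ.* i) * x ^ (w ℕ.* j)      ≈⟨ *-cong (multiple i u x^i≈1) (multiple j w x^j≈1) ⟩
    1# * 1#                            ≈⟨ *-identityˡ 1# ⟩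
    1#                                 ∎
    where
    multiple : ∀ i k → x ^ i ≈ 1# → x ^ (k ℕ.* i) ≈ 1#
    multiple i k eq = trans (^-congʳ x (ℕ.*-comm k i)) (x^i≈1⇒x^[i*j]≈1 i k eq)

  -- f is a polynomial function of formal degree D with D-th coefficient u, possibly 0.
  data Leading (u : Carrier) : ℕ → (Carrier → Carrier) → Set (c ⊔ ℓ) where
    constant : ∀ {f} → (∀ x → f x ≈ u) → Leading u 0 f
    step     : ∀ {D f} b g → Leading u D g → (∀ x → f x ≈ b + x * g x) → Leading u (suc D) f

  leading-≈ : ∀ {u v D f g} → u ≈ v → (∀ x → f x ≈ g x) → Leading u D f → Leading v D g
  leading-≈ u≈v f≈g (constant f≈u)    = constant (λ x → trans (sym (f≈g x)) (trans (f≈u x) u≈v))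
  leading-≈ u≈v f≈g (step b h lead f≈) =
    step b h (leading-≈ u≈v (λ _ → refl) lead) (λ x → trans (sym (f≈g x)) (f≈ x))

  leading-+ : ∀ {u v D f g} → Leading u D f → Leading v D g → Leading (u + v) D (λ x → f x + g x)
  leading-+ (constant f≈u) (constant g≈v) = constant (λ x → +-cong (f≈u x) (g≈v x))
  leading-+ (step b h lead f≈) (step b′ h′ lead′ g≈) =
    step (b + b′) (λ x → h x + h′ x) (leading-+ lead lead′) (λ x → trans (+-cong (f≈ x) (g≈ x))
      (solve 5 (λ b b′ x h h′ → (b :+ x :* h) :+ (b′ :+ x :* h′) := (b :+ b′) :+ x :* (h :+ h′)) refl
             b b′ x (h x) (h′ x)))

  leading-* : ∀ {u D f} k → Leading u D f → Leading (k * u) D (λ x → k * f x)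
  leading-* k (constant f≈u) = constant (λ x → *-congˡ (f≈u x))
  leading-* k (step b h lead f≈) = step (k * b) (λ x → k * h x) (leading-* k lead) (λ x → trans (*-congˡ (f≈ x))
    (solve 4 (λ k b x h → k :* (b :+ x :* h) := k :* b :+ x :* (k :* h)) refl k b x (h x)))

  leading-shift : ∀ {u D f} → Leading u D f → Leading u (suc D) (λ x → x * f x)
  leading-shift {f = f} lead = step 0# f lead (λ x → sym (+-identityˡ _))

  leading-suc : ∀ {u D f} → Leading u D f → Leading 0# (suc D) f
  leading-suc {u} (constant f≈u) = step u (λ _ → 0#) (constant (λ _ → refl)) (λ x → trans (f≈u x)
    (solve 2 (λ u x → u := u :+ x :* con 0) refl u x))
  leading-suc (step b h lead f≈) = step b h (leading-suc lead) f≈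

  -- Padding with zero coefficients allows a summand of lower degree to be added by `leading-+`
  -- without affecting the leading coefficient.
  leading-raise : ∀ {u D D′ f} → D < D′ → Leading u D f → Leading 0# D′ f
  leading-raise D<D′ = helper (ℕ.<⇒<′ D<D′)
    where
    helper : ∀ {u D D′ f} → D ℕ.<′ D′ → Leading u D f → Leading 0# D′ f
    helper ℕ.≤′-refl      lead = leading-suc lead
    helper (ℕ.≤′-step lt) lead = leading-suc (helper lt lead)

  leading-^ : ∀ D → Leading 1# D (_^ D)
  leading-^ zero    = constant (λ _ → refl)
  leading-^ (suc D) = leading-shift (leading-^ D)

  -- f(x) − f(b) = (x − b) g(x), with the terms moved so that none is subtracted.
  synthetic-division : ∀ {u D f} → Leading u (suc D) f → ∀ b →
                       ∃ λ g → Leading u D g × (∀ x → f x + b * g x ≈ f b + x * g x)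
  synthetic-division {u} {f = f} (step a h (constant h≈u) f≈) b = (λ _ → u) , constant (λ _ → refl) , λ x → begin
    f x + b * u            ≈⟨ +-congʳ (trans (f≈ x) (+-congˡ (*-congˡ (h≈u x)))) ⟩
    (a + x * u) + b * u    ≈⟨ solve 4 (λ a x u b → (a :+ x :* u) :+ b :* u := (a :+ b :* u) :+ x :* u) refl a x u b ⟩
    (a + b * u) + x * u    ≈⟨ +-congʳ (sym (trans (f≈ b) (+-congˡ (*-congˡ (h≈u b))))) ⟩
    f b + x * u            ∎
  synthetic-division {u} {suc D} {f} (step a h lead@(step _ _ _ _) f≈) b
    with k , lead-k , h≈ ← synthetic-division lead b =
    (λ x → h b + x * k x) , step (h b) k lead-k (λ _ → refl) , λ x → begin
    f x + b * (h b + x * k x)                ≈⟨ +-congʳ (f≈ x) ⟩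
    (a + x * h x) + b * (h b + x * k x)      ≈⟨ solve 6 (λ a x hx b hb k → (a :+ x :* hx) :+ b :* (hb :+ x :* k)
                                                  := (a :+ b :* hb) :+ x :* (hx :+ b :* k)) refl a x (h x) b (h b) (k x) ⟩
    (a + b * h b) + x * (h x + b * k x)      ≈⟨ +-cong (sym (f≈ b)) (*-congˡ (h≈ x)) ⟩
    f b + x * (h b + x * k x)                ∎

  -- Dividing by the root `e zero` lowers the degree by one and keeps the leading coefficient; the
  -- other roots differ from `e zero`, so they are roots of the quotient.
  root-bound : ∀ {u D f n} → u ≉ 0# → Leading u D f → (e : Fin n → Carrier) → Injective _≡_ _≈_ e →
               (∀ i → f (e i) ≈ 0#) → n ≤ D
  root-bound {n = zero}  _   _              _ _     _     = z≤n
  root-bound {n = suc n} u≉0 (constant f≈u) e _     roots =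
    contradiction (trans (sym (f≈u (e zero))) (roots zero)) u≉0
  root-bound {f = f} {suc n} u≉0 lead@(step _ _ _ _) e e-inj roots
    with g , lead-g , f≈ ← synthetic-division lead (e zero) =
    s≤s (root-bound u≉0 lead-g (e ∘ suc) (Fin.suc-injective ∘ e-inj) g-roots)
    where
    g-roots : ∀ i → g (e (suc i)) ≈ 0#
    g-roots i with g (e (suc i)) ≈? 0#
    ... | yes g≈0 = g≈0
    ... | no  g≉0 = contradiction (e-inj (*-cancelʳ-≉0 g≉0 (+-cancelˡ 0# _ _ (begin
      0# + e zero * g (e (suc i))             ≈⟨ +-congʳ (sym (roots (suc i))) ⟩
      f (e (suc i)) + e zero * g (e (suc i))  ≈⟨ f≈ (e (suc i)) ⟩
      f (e zero) + e (suc i) * g (e (suc i))  ≈⟨ +-congʳ (roots zero) ⟩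
      0# + e (suc i) * g (e (suc i))          ∎)))) (λ ())

  -- The source of all existence statements below: e-th roots, an element of nonzero trace, and an
  -- element avoiding prescribed powers. Decidable equality on a finite set turns the failure of
  -- "all are roots" into a witness.
  non-root : ∀ {u D f} → u ≉ 0# → Leading u D f → D < N → ∃ λ x → f x ≉ 0#
  non-root {f = f} u≉0 lead D<N
    with i , fi≉0 ← Fin.¬∀⟶∃¬ N (λ i → f (element i) ≈ 0#) (λ i → f (element i) ≈? 0#)
                      (λ roots → ℕ.<⇒≱ D<N (root-bound u≉0 lead element element-injective roots))
    = element i , fi≉0

  module _ (e : ℕ) .{{_ : NonZero e}} (a : Carrier) where
    private
      quotient : ℕ → Carrier → Carrier
      quotient zero    x = 0#
      quotient (suc j) x = x ^ (e ℕ.* j) + a * quotient j x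

      -- (xᵉ − a) Q_j(x) = xᵉʲ − aʲ
      quotient-spec : ∀ j x → x ^ e * quotient j x + a ^ j ≈ x ^ (e ℕ.* j) + a * quotient j x
      quotient-spec zero x = begin
        x ^ e * 0# + 1#              ≈⟨ solve 2 (λ y a → y :* con 0 :+ con 1 := con 1 :+ a :* con 0) refl (x ^ e) a ⟩
        1# + a * 0#                  ≡⟨ ≡.cong (λ k → x ^ k + a * 0#) (≡.sym (ℕ.*-zeroʳ e)) ⟩
        x ^ (e ℕ.* 0) + a * 0#       ∎
      quotient-spec (suc j) x = begin
        y * (z + a * Q) + a * a ^ j   ≈⟨ solve 5 (λ y z a Q A → y :* (z :+ a :* Q) :+ a :* A := y :* z :+ a :* (y :* Q :+ A)) refl y z a Q (a ^ j) ⟩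
        y * z + a * (y * Q + a ^ j)   ≈⟨ +-cong (sym (^-homo-* x e (e ℕ.* j))) (*-congˡ (quotient-spec j x)) ⟩
        x ^ (e ℕ.+ e ℕ.* j) + a * (z + a * Q)  ≡⟨ ≡.cong (λ k → x ^ k + a * (z + a * Q)) (≡.sym (ℕ.*-suc e j)) ⟩
        x ^ (e ℕ.* suc j) + a * (z + a * Q)    ∎
        where
        y = x ^ e
        z = x ^ (e ℕ.* j)
        Q = quotient j x

      quotient-leading : ∀ j → Leading 1# (e ℕ.* j) (quotient (suc j))
      quotient-leading zero = leading-≈ (trans (+-congˡ (zeroʳ a)) (+-identityʳ 1#)) (λ _ → refl)
        (leading-+ (leading-^ (e ℕ.* 0)) (leading-* a zeros))
        where
        zeros : Leading 0# (e ℕ.* 0) (λ _ → 0#)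
        zeros = ≡.subst (λ k → Leading 0# k (λ _ → 0#)) (≡.sym (ℕ.*-zeroʳ e)) (constant (λ _ → refl))
      quotient-leading (suc j) = leading-≈ (trans (+-congˡ (zeroʳ a)) (+-identityʳ 1#)) (λ _ → refl)
        (leading-+ (leading-^ (e ℕ.* suc j)) (leading-* a
          (leading-raise (ℕ.*-monoʳ-< e (ℕ.n<1+n j)) (quotient-leading j))))

      -- The extra factor x brings the degree to `e * j + 1`, at most `e * suc j` because `e` is
      -- positive, hence below `n`.
      below : ∀ {n j} → Fin n → n ∸ 1 ≡ e ℕ.* suc j → suc (e ℕ.* j) < n
      below {suc n} {j} _ n≡ = s≤s (ℕ.<-≤-trans (ℕ.*-monoʳ-< e (ℕ.n<1+n j)) (ℕ.≤-reflexive (≡.sym n≡)))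

    -- x (xᵉ − a) Q(x) = x^N − x vanishes on all of F, but x Q(x) has degree < N.
    power-root : ∀ h → N ∸ 1 ≡ e ℕ.* h → .{{_ : NonZero h}} → a ^ h ≈ 1# → ∃ λ t → t ^ e ≈ a
    power-root (suc j) N∸1≡ a^h≈1
      with x , xQ≉0 ← non-root 1≉0 (leading-shift (quotient-leading j)) (below (index 0#) N∸1≡)
      = x , *-cancelʳ-≉0 (factor-≉0ʳ xQ≉0) (+-cancelʳ 1# _ _ (begin
        x ^ e * Q x + 1#              ≈⟨ +-congˡ (sym a^h≈1) ⟩
        x ^ e * Q x + a ^ suc j       ≈⟨ quotient-spec (suc j) x ⟩
        x ^ (e ℕ.* suc j) + a * Q x   ≈⟨ +-congʳ (trans (^-congʳ x (≡.sym N∸1≡)) (x^[N∸1]≈1 (factor-≉0ˡ xQ≉0))) ⟩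
        1# + a * Q x                  ≈⟨ +-comm _ _ ⟩
        a * Q x + 1#                  ∎))
      where
      Q = quotient (suc j)

open import Data.Integer.Base using (∣_∣; +_; _-_)

-- Characteristic two and the Frobenius powers.

module CharacteristicTwo {c ℓ N} (F : FiniteField c ℓ N) (r : ℕ) (N≡2^r : N ≡ 2 ℕ.^ r) where
  open FiniteField F hiding (zero; _-_)
  open FiniteFieldProperties F
  open CommutativeRing commutativeRing using (setoid)
  open import Algebra.Properties.Semiring.Mult semiring using (×1-homo-*) renaming (_×_ to _·_)
  open import Algebra.Solver.Ring.NaturalCoefficients.Default commutativeSemiring
  open import Relation.Binary.Reasoning.Setoid setoid

  -- N·1 vanishes and equals (1 + 1)^r, and a power of a nonzero element is nonzero.
  1+1≈0 : 1# + 1# ≈ 0#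
  1+1≈0 with 1# + 1# ≈? 0#
  ... | yes eq = eq
  ... | no neq = contradiction (trans (sym (2^k·1 r)) (≡.subst (λ n → n · 1# ≈ 0#) N≡2^r N·1≈0)) (^-≉0 r neq)
    where
    2^k·1 : ∀ k → (2 ℕ.^ k) · 1# ≈ (1# + 1#) ^ k
    2^k·1 zero    = +-identityʳ 1#
    2^k·1 (suc k) = trans (×1-homo-* 2 (2 ℕ.^ k)) (*-cong (+-congˡ (+-identityʳ 1#)) (2^k·1 k))

  x+x≈0 : ∀ x → x + x ≈ 0#
  x+x≈0 x = begin
    x + x            ≈⟨ sym (+-cong (*-identityˡ x) (*-identityˡ x)) ⟩
    1# * x + 1# * x  ≈⟨ sym (distribʳ x 1# 1#) ⟩
    (1# + 1#) * x    ≈⟨ *-congʳ 1+1≈0 ⟩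
    0# * x           ≈⟨ zeroˡ x ⟩
    0#               ∎

  x+y≈0⇒x≈y : ∀ {x y} → x + y ≈ 0# → x ≈ y
  x+y≈0⇒x≈y {x} {y} eq = +-cancelʳ y x y (trans eq (sym (x+x≈0 y)))

  x≈y⇒x+y≈0 : ∀ {x y} → x ≈ y → x + y ≈ 0#
  x≈y⇒x+y≈0 {x} {y} eq = trans (+-congʳ eq) (x+x≈0 y)

  +-cancel-middle : ∀ x y → (x + y) + y ≈ x
  +-cancel-middle x y = trans (+-assoc x y y) (trans (+-congˡ (x+x≈0 y)) (+-identityʳ x))

  frobenius-+ : ∀ k x y → (x + y) ^ (2 ℕ.^ k) ≈ x ^ (2 ℕ.^ k) + y ^ (2 ℕ.^ k)
  frobenius-+ zero    x y = trans (*-identityʳ _) (sym (+-cong (*-identityʳ x) (*-identityʳ y)))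
  frobenius-+ (suc k) x y = begin
    (x + y) ^ (2 ℕ.^ suc k)                      ≈⟨ sym (^-assocʳ (x + y) 2 (2 ℕ.^ k)) ⟩
    ((x + y) ^ 2) ^ (2 ℕ.^ k)                    ≈⟨ ^-congˡ (2 ℕ.^ k) square ⟩
    (x ^ 2 + y ^ 2) ^ (2 ℕ.^ k)                  ≈⟨ frobenius-+ k (x ^ 2) (y ^ 2) ⟩
    (x ^ 2) ^ (2 ℕ.^ k) + (y ^ 2) ^ (2 ℕ.^ k)    ≈⟨ +-cong (^-assocʳ x 2 (2 ℕ.^ k)) (^-assocʳ y 2 (2 ℕ.^ k)) ⟩
    x ^ (2 ℕ.^ suc k) + y ^ (2 ℕ.^ suc k)        ∎
    where
    square : (x + y) ^ 2 ≈ x ^ 2 + y ^ 2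
    square = begin
      (x + y) ^ 2                      ≈⟨ solve 2 (λ x y → (x :+ y) :^ 2 := (x :^ 2 :+ y :^ 2) :+ (x :* y :+ x :* y)) refl x y ⟩
      (x ^ 2 + y ^ 2) + (x * y + x * y)  ≈⟨ +-congˡ (x+x≈0 (x * y)) ⟩
      (x ^ 2 + y ^ 2) + 0#             ≈⟨ +-identityʳ _ ⟩
      x ^ 2 + y ^ 2                    ∎

  frobenius-0 : ∀ k → 0# ^ (2 ℕ.^ k) ≈ 0#
  frobenius-0 zero    = zeroˡ _
  frobenius-0 (suc k) = trans (sym (^-assocʳ 0# 2 (2 ℕ.^ k))) (trans (^-congˡ (2 ℕ.^ k) (zeroˡ _)) (frobenius-0 k))

  frobenius-∘ : ∀ j k x → (x ^ (2 ℕ.^ j)) ^ (2 ℕ.^ k) ≈ x ^ (2 ℕ.^ (j ℕ.+ k))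
  frobenius-∘ j k x = trans (^-assocʳ x (2 ℕ.^ j) (2 ℕ.^ k)) (^-congʳ x (≡.sym (ℕ.^-distribˡ-+-* 2 j k)))

  frobenius-surjective : ∀ k y → ∃ λ x → x ^ (2 ℕ.^ k) ≈ y
  frobenius-surjective k y
    with x , x^≈y ← injective⇒surjective (^-congˡ (2 ℕ.^ k))
      (λ {x} {z} eq → x+y≈0⇒x≈y (x^k≈0⇒x≈0 (2 ℕ.^ k) (trans (frobenius-+ k x z) (x≈y⇒x+y≈0 eq)))) y
    = x , x^≈y refl

  x^[2^r]≈x : ∀ x → x ^ (2 ℕ.^ r) ≈ x
  x^[2^r]≈x x = trans (^-congʳ x (≡.sym N≡2^r)) (x^N≈x x)

  frobenius-periodic : ∀ k i x → x ^ (2 ℕ.^ (k ℕ.+ i ℕ.* r)) ≈ x ^ (2 ℕ.^ k)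
  frobenius-periodic k i x = trans (sym (frobenius-∘ k (i ℕ.* r) x)) (period i (x ^ (2 ℕ.^ k)))
    where
    period : ∀ i x → x ^ (2 ℕ.^ (i ℕ.* r)) ≈ x
    period zero    x = *-identityʳ x
    period (suc i) x = trans (sym (frobenius-∘ r (i ℕ.* r) x)) (trans (period i _) (x^[2^r]≈x x))

  -- Partial norms and Hilbert 90.

  private
    -- The norm of t along x ↦ x^(2ʲ), cut off after k factors.
    partialNorm : ℕ → Carrier → ℕ → Carrier
    partialNorm j t zero    = 1#
    partialNorm j t (suc k) = t * partialNorm j t k ^ (2 ℕ.^ j)

    partialNorm-≉0 : ∀ j {t} k → t ≉ 0# → partialNorm j t k ≉ 0#
    partialNorm-≉0 j zero    t≉0 = 1≉0
    partialNorm-≉0 j (suc k) t≉0 = *-≉0 t≉0 (^-≉0 (2 ℕ.^ j) (partialNorm-≉0 j k t≉0))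

    -- Both sides are the product of t^(2^(ij)) over i = 0, ..., k, with the first or the last
    -- factor split off.
    partialNorm-shift : ∀ j t k → partialNorm j t k ^ (2 ℕ.^ j) * t ≈ partialNorm j t k * t ^ (2 ℕ.^ (k ℕ.* j))
    partialNorm-shift j t zero    = *-cong (1^k≈1 (2 ℕ.^ j)) (sym (*-identityʳ t))
    partialNorm-shift j t (suc k) = begin
      φ (t * φ ν) * t                       ≈⟨ *-congʳ (^-distrib-* t (φ ν) (2 ℕ.^ j)) ⟩
      φ t * φ (φ ν) * t                     ≈⟨ solve 3 (λ a b c → a :* b :* c := c :* (b :* a)) refl (φ t) (φ (φ ν)) t ⟩
      t * (φ (φ ν) * φ t)                   ≈⟨ *-congˡ (sym (^-distrib-* (φ ν) t (2 ℕ.^ j))) ⟩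
      t * φ (φ ν * t)                       ≈⟨ *-congˡ (^-congˡ (2 ℕ.^ j) (partialNorm-shift j t k)) ⟩
      t * φ (ν * t ^ (2 ℕ.^ (k ℕ.* j)))     ≈⟨ *-congˡ (^-distrib-* ν _ (2 ℕ.^ j)) ⟩
      t * (φ ν * φ (t ^ (2 ℕ.^ (k ℕ.* j)))) ≈⟨ sym (*-assoc _ _ _) ⟩
      t * φ ν * φ (t ^ (2 ℕ.^ (k ℕ.* j)))   ≈⟨ *-congˡ (trans (frobenius-∘ (k ℕ.* j) j t) (^-congʳ t (≡.cong (2 ℕ.^_) (ℕ.+-comm (k ℕ.* j) j)))) ⟩
      t * φ ν * t ^ (2 ℕ.^ (suc k ℕ.* j))   ∎
      where
      φ : Carrier → Carrier
      φ x = x ^ (2 ℕ.^ j)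
      ν = partialNorm j t k

  module _ .{{_ : NonZero r}} {a : Carrier} (a≉0 : a ≉ 0#) where
    module _ (j : ℕ) where
      private
        d = gcd j r
        e = 2 ℕ.^ d ∸ 1
        instance
          e≢0 : NonZero e
          e≢0 = 2^gcd∸1≢0 j r
        E = (2 ℕ.^ r ∸ 1) / e

        eE≡2^r∸1 : e ℕ.* E ≡ 2 ℕ.^ r ∸ 1
        eE≡2^r∸1 = ℕ.m*[n/m]≡n (2^d∸1∣2^m∸1 (gcd[m,n]∣n j r))

        E≢0 : NonZero E
        E≢0 = ℕ.m*n≢0⇒n≢0 e {{≡.subst NonZero (≡.sym eE≡2^r∸1) (2^m∸1≢0 r)}}

      -- Write a = t^(2^d - 1) and choose x with xj ≡ d modulo r. For the partial norm v of t with x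
      -- factors the quotient v^(2^j) / v telescopes to t^(2^(xj)) / t, which is t^(2^d) / t = a.
      hilbert90 : a ^ E ≈ 1# → ∃ λ v → v ≉ 0# × v ^ (2 ℕ.^ j) ≈ v * a
      hilbert90 a^E≈1
        with t , t^e≈a ← power-root e a E (≡.trans (≡.cong (_∸ 1) N≡2^r) (≡.sym eE≡2^r∸1)) {{E≢0}} a^E≈1
           | x , y , z , eq ← bézout j r =
        let t≉0 = x^k≉0⇒x≉0 e (a≉0 ∘ trans (sym t^e≈a))
            v   = partialNorm j t x
        in v , partialNorm-≉0 j x t≉0 , *-cancelʳ-≉0 t≉0 (begin
        v ^ (2 ℕ.^ j) * t                       ≈⟨ partialNorm-shift j t x ⟩
        v * t ^ (2 ℕ.^ (x ℕ.* j))               ≈⟨ *-congˡ (sym (frobenius-periodic (x ℕ.* j) z t)) ⟩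
        v * t ^ (2 ℕ.^ (x ℕ.* j ℕ.+ z ℕ.* r))   ≡⟨ ≡.cong (λ k → v * t ^ (2 ℕ.^ k)) (≡.sym eq) ⟩
        v * t ^ (2 ℕ.^ (d ℕ.+ y ℕ.* r))         ≈⟨ *-congˡ (frobenius-periodic d y t) ⟩
        v * t ^ (2 ℕ.^ d)                       ≡⟨ ≡.cong (λ k → v * t ^ k) (≡.sym (suc[b^k∸1]≡b^k 2 d)) ⟩
        v * (t * t ^ e)                         ≈⟨ *-congˡ (trans (*-congˡ t^e≈a) (*-comm t a)) ⟩
        v * (a * t)                             ≈⟨ sym (*-assoc v a t) ⟩
        v * a * t                               ∎)

      -- As 2^d - 1 divides 2^j - 1, the product (2^j - 1)E is a multiple of N - 1. Raising a v^(2^j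
      -- - 1) = 1 to the power E therefore removes v.
      hilbert90⁻¹ : ∀ {v} → v ≉ 0# → a * v ^ (2 ℕ.^ j) ≈ v → a ^ E ≈ 1#
      hilbert90⁻¹ {v} v≉0 av^≈v with divides k 2^j∸1≡ke ← 2^d∸1∣2^m∸1 (gcd[m,n]∣m j r) = begin
        a ^ E                                   ≈⟨ sym (*-identityʳ _) ⟩
        a ^ E * 1#                              ≈⟨ *-congˡ (sym v^≈1) ⟩
        a ^ E * (v ^ (2 ℕ.^ j ∸ 1)) ^ E         ≈⟨ sym (^-distrib-* a _ E) ⟩
        (a * v ^ (2 ℕ.^ j ∸ 1)) ^ E             ≈⟨ ^-congˡ E av^≈1 ⟩
        1# ^ E                                  ≈⟨ 1^k≈1 E ⟩
        1#                                      ∎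
        where
        av^≈1 : a * v ^ (2 ℕ.^ j ∸ 1) ≈ 1#
        av^≈1 = *-cancelˡ-≉0 v≉0 (begin
          v * (a * v ^ (2 ℕ.^ j ∸ 1))  ≈⟨ solve 3 (λ a v w → v :* (a :* w) := a :* (v :* w)) refl a v _ ⟩
          a * v ^ suc (2 ℕ.^ j ∸ 1)    ≡⟨ ≡.cong (λ k → a * v ^ k) (suc[b^k∸1]≡b^k 2 j) ⟩
          a * v ^ (2 ℕ.^ j)            ≈⟨ av^≈v ⟩
          v                            ≈⟨ sym (*-identityʳ v) ⟩
          v * 1#                       ∎)

        exponent : (2 ℕ.^ j ∸ 1) ℕ.* E ≡ (N ∸ 1) ℕ.* k
        exponent = *-transfer 2^j∸1≡ke (≡.trans eE≡2^r∸1 (≡.cong (_∸ 1) (≡.sym N≡2^r)))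

        v^≈1 : (v ^ (2 ℕ.^ j ∸ 1)) ^ E ≈ 1#
        v^≈1 = trans (^-assocʳ v (2 ℕ.^ j ∸ 1) E)
                 (trans (^-congʳ v exponent) (x^i≈1⇒x^[i*j]≈1 (N ∸ 1) k (x^[N∸1]≈1 v≉0)))

    -- For l = 0 the equation is a u = u^2, with root a. For l = j + 1 take u with u^2 = 1/v: then a
    -- u^(2^l) = a / v^(2^j) = 1/v.
    hilbert90⇒kernel : ∀ l → (∃ λ v → v ≉ 0# × v ^ (2 ℕ.^ ∣ + l - + 1 ∣) ≈ v * a) →
                       ∃ λ u → u ≉ 0# × a * u ^ (2 ℕ.^ l) ≈ u ^ 2
    hilbert90⇒kernel zero    _ = a , a≉0 , refl
    hilbert90⇒kernel (suc j) (v , v≉0 , v^≈va) =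
      let w , wv≈1 , _ = invertible v v≉0
          u , u²≈w     = frobenius-surjective 1 w
          w≉0          = factor-≉0ˡ (λ wv≈0 → 1≉0 (trans (sym wv≈1) wv≈0))
      in u , x^k≉0⇒x≉0 2 (w≉0 ∘ trans (sym u²≈w)) , (begin
      a * u ^ (2 ℕ.^ suc j)          ≈⟨ *-congˡ (sym (^-assocʳ u 2 (2 ℕ.^ j))) ⟩
      a * (u ^ 2) ^ (2 ℕ.^ j)        ≈⟨ *-congˡ (^-congˡ (2 ℕ.^ j) u²≈w) ⟩
      a * w ^ (2 ℕ.^ j)              ≈⟨ *-cancelʳ-≉0 v≉0 (awv≈wv w wv≈1) ⟩
      w                              ≈⟨ sym u²≈w ⟩
      u ^ 2                          ∎)
      where
      awv≈wv : ∀ w → w * v ≈ 1# → a * w ^ (2 ℕ.^ j) * v ≈ w * v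
      awv≈wv w wv≈1 = begin
        a * w ^ (2 ℕ.^ j) * v          ≈⟨ solve 3 (λ a x v → a :* x :* v := x :* (v :* a)) refl a (w ^ (2 ℕ.^ j)) v ⟩
        w ^ (2 ℕ.^ j) * (v * a)        ≈⟨ *-congˡ (sym v^≈va) ⟩
        w ^ (2 ℕ.^ j) * v ^ (2 ℕ.^ j)  ≈⟨ sym (^-distrib-* w v (2 ℕ.^ j)) ⟩
        (w * v) ^ (2 ℕ.^ j)            ≈⟨ trans (^-congˡ (2 ℕ.^ j) wv≈1) (1^k≈1 (2 ℕ.^ j)) ⟩
        1#                             ≈⟨ sym wv≈1 ⟩
        w * v                          ∎

    -- For l = 0 the equation forces u = a and |l - 1| is 1, so v = 1/u works; for l = j + 1 the
    -- substitution is v = u^2.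
    kernel⇒hilbert90 : ∀ l {u} → u ≉ 0# → a * u ^ (2 ℕ.^ l) ≈ u ^ 2 → ∃ λ v → v ≉ 0# × a * v ^ (2 ℕ.^ ∣ + l - + 1 ∣) ≈ v
    kernel⇒hilbert90 zero {u} u≉0 eq with v , vu≈1 , uv≈1 ← invertible u u≉0 =
      v , factor-≉0ˡ {y = u} (λ vu≈0 → 1≉0 (trans (sym vu≈1) vu≈0)) , (begin
      a * v ^ 2        ≈⟨ *-congʳ (*-cancelʳ-≉0 (^-≉0 1 u≉0) eq) ⟩
      u * v ^ 2        ≈⟨ sym (*-assoc u v (v ^ 1)) ⟩
      u * v * v ^ 1    ≈⟨ *-cong uv≈1 (*-identityʳ v) ⟩
      1# * v           ≈⟨ *-identityˡ v ⟩
      v                ∎)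
    kernel⇒hilbert90 (suc j) {u} u≉0 eq =
      u ^ 2 , ^-≉0 2 u≉0 , trans (*-congˡ (^-assocʳ u 2 (2 ℕ.^ j))) eq

    module _ (l : ℕ) where
      private instance _ = 2^gcd∸1≢0 ∣ + l - + 1 ∣ r

      a^E≈1⇔kernel : a ^ ((2 ℕ.^ r ∸ 1) / (2 ℕ.^ gcd ∣ + l - + 1 ∣ r ∸ 1)) ≈ 1# ⇔
                     (∃ λ u → u ≉ 0# × a * u ^ (2 ℕ.^ l) ≈ u ^ 2)
      a^E≈1⇔kernel = mk⇔
        (λ a^E≈1 → hilbert90⇒kernel l (hilbert90 ∣ + l - + 1 ∣ a^E≈1))
        (λ (u , u≉0 , eq) → let v , v≉0 , av^≈v = kernel⇒hilbert90 l u≉0 eq in hilbert90⁻¹ ∣ + l - + 1 ∣ v≉0 av^≈v)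

-- The elements fixed by the q-th power, within L.

module TracePermutation {c₁ ℓ} (m n : ℕ) .{{_ : NonZero m}} .{{_ : NonZero n}}
         (L : FiniteField c₁ ℓ ((2 ℕ.^ m) ℕ.^ n)) where
  open FiniteField L hiding (zero; _-_)
  open FiniteFieldProperties L
  open CharacteristicTwo L (m ℕ.* n) (ℕ.^-*-assoc 2 m n)
  open CommutativeRing commutativeRing using (setoid)
  open import Algebra.Properties.CommutativeMonoid.Sum +-commutativeMonoid
    using (sum; sum-cong-≋; sum-init-last; sum-replicate; ∑-distrib-+)
  open import Algebra.Properties.Semiring.Sum semiring using (*-distribˡ-sum)
  open import Algebra.Properties.Semiring.Mult semiring using () renaming (_×_ to _·_)
  open import Algebra.Solver.Ring.NaturalCoefficients.Default commutativeSemiring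
  open import Relation.Binary.Reasoning.Setoid setoid

  q : ℕ
  q = 2 ℕ.^ m

  instance
    q≢0 : NonZero q
    q≢0 = ℕ.m^n≢0 2 m

  -- Counting the roots of X^q − X shows that these are the elements of K.
  Fixed : Carrier → Set ℓ
  Fixed x = x ^ q ≈ x

  fixed-≈ : ∀ {x y} → x ≈ y → Fixed x → Fixed y
  fixed-≈ x≈y fix = trans (^-congˡ q (sym x≈y)) (trans fix x≈y)

  fixed-+ : ∀ {x y} → Fixed x → Fixed y → Fixed (x + y)
  fixed-+ fix-x fix-y = trans (frobenius-+ m _ _) (+-cong fix-x fix-y)

  fixed-* : ∀ {x y} → Fixed x → Fixed y → Fixed (x * y)
  fixed-* fix-x fix-y = trans (^-distrib-* _ _ q) (*-cong fix-x fix-y)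

  fixed-0 : Fixed 0#
  fixed-0 = frobenius-0 m

  fixed-1 : Fixed 1#
  fixed-1 = 1^k≈1 q

  fixed-inverse : ∀ {x y} → Fixed x → x * y ≈ 1# → Fixed y
  fixed-inverse {x} {y} fix xy≈1 = *-cancelˡ-≉0 (factor-≉0ˡ (1≉0 ∘ trans (sym xy≈1))) (begin
    x * y ^ q        ≈⟨ *-congʳ (sym fix) ⟩
    x ^ q * y ^ q    ≈⟨ sym (^-distrib-* x y q) ⟩
    (x * y) ^ q      ≈⟨ ^-congˡ q xy≈1 ⟩
    1# ^ q           ≈⟨ fixed-1 ⟩
    1#               ≈⟨ sym xy≈1 ⟩
    x * y            ∎)

  fixed-iterate : ∀ {x} i → Fixed x → x ^ (q ℕ.^ i) ≈ x
  fixed-iterate {x} zero    fix = *-identityʳ x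
  fixed-iterate {x} (suc i) fix = trans (sym (^-assocʳ x q (q ℕ.^ i))) (trans (^-congˡ (q ℕ.^ i) fix) (fixed-iterate i fix))

  inverse : ∀ {x} → x ≉ 0# → ∃ λ y → x * y ≈ 1#
  inverse {x} x≉0 = let y , _ , xy≈1 = invertible x x≉0 in y , xy≈1

  frobenius-sum : ∀ k {j} (t : Fin j → Carrier) → sum t ^ (2 ℕ.^ k) ≈ sum (λ i → t i ^ (2 ℕ.^ k))
  frobenius-sum k {zero}  t = frobenius-0 k
  frobenius-sum k {suc j} t = trans (frobenius-+ k _ _) (+-congˡ (frobenius-sum k (t ∘ suc)))

  -- The trace and its linear forms.

  tr : Carrier → Carrier
  tr x = sum {n} (λ i → x ^ (q ℕ.^ toℕ i))

  tr-cong : ∀ {x y} → x ≈ y → tr x ≈ tr y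
  tr-cong x≈y = sum-cong-≋ {n} (λ i → ^-congˡ (q ℕ.^ toℕ i) x≈y)

  frobenius-q-+ : ∀ i x y → (x + y) ^ (q ℕ.^ i) ≈ x ^ (q ℕ.^ i) + y ^ (q ℕ.^ i)
  frobenius-q-+ i x y = ≡.subst (λ k → (x + y) ^ k ≈ x ^ k + y ^ k) (≡.sym (ℕ.^-*-assoc 2 m i)) (frobenius-+ (m ℕ.* i) x y)

  tr-+ : ∀ x y → tr (x + y) ≈ tr x + tr y
  tr-+ x y = trans (sum-cong-≋ {n} (λ i → frobenius-q-+ (toℕ i) x y)) (∑-distrib-+ {n} _ _)

  tr-* : ∀ {c} → Fixed c → ∀ x → tr (c * x) ≈ c * tr x
  tr-* {c} fix x = trans
    (sum-cong-≋ {n} (λ i → trans (^-distrib-* c x (q ℕ.^ toℕ i)) (*-congʳ (fixed-iterate (toℕ i) fix))))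
    (sym (*-distribˡ-sum {n} c _))

  tr-frobenius : ∀ k x → tr (x ^ (2 ℕ.^ k)) ≈ tr x ^ (2 ℕ.^ k)
  tr-frobenius k x = trans (sum-cong-≋ {n} (λ i → ^-swap x (2 ℕ.^ k) (q ℕ.^ toℕ i))) (sym (frobenius-sum k {n} _))

  sum-snoc : ∀ k (h : ℕ → Carrier) → sum {suc k} (λ i → h (toℕ i)) ≈ sum {k} (λ i → h (toℕ i)) + h k
  sum-snoc k h = trans (sum-init-last {k} (λ i → h (toℕ i)))
    (+-cong (sum-cong-≋ {k} (λ i → reflexive (≡.cong h (Fin.toℕ-inject₁ i)))) (reflexive (≡.cong h (Fin.toℕ-fromℕ k))))

  -- The sum of x^(q^i) over i = 0, ..., n is split at either end; the last term x^(q^n) equals the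
  -- first term x and cancels.
  tr-fixed : ∀ x → Fixed (tr x)
  tr-fixed x = +-cancelʳ x _ _ (begin
    tr x ^ q + x                                          ≈⟨ +-cong (frobenius-sum m {n} _) (sym (*-identityʳ x)) ⟩
    sum {n} (λ i → (x ^ (q ℕ.^ toℕ i)) ^ q) + x ^ 1
      ≈⟨ +-congʳ (sum-cong-≋ {n} (λ i → trans (^-assocʳ x (q ℕ.^ toℕ i) q) (^-congʳ x (ℕ.*-comm (q ℕ.^ toℕ i) q)))) ⟩
    sum {n} (λ i → x ^ (q ℕ.^ suc (toℕ i))) + x ^ 1       ≈⟨ trans (+-comm _ _) (sum-snoc n (λ i → x ^ (q ℕ.^ i))) ⟩
    tr x + x ^ (q ℕ.^ n)                                  ≈⟨ +-congˡ (x^N≈x x) ⟩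
    tr x + x                                              ∎)

  private
    n·x : ∀ {x} → Fixed x → tr x ≈ n · x
    n·x fix = trans (sum-cong-≋ {n} (λ i → fixed-iterate (toℕ i) fix)) (sum-replicate n)

    even·x : ∀ k x → (k ℕ.* 2) · x ≈ 0#
    even·x zero    x = refl
    even·x (suc k) x = trans (+-congˡ (+-congˡ (even·x k x))) (trans (+-congˡ (+-identityʳ x)) (x+x≈0 x))

  tr-even : 2 ∣ n → ∀ {x} → Fixed x → tr x ≈ 0#
  tr-even (divides k n≡k*2) {x} fix = trans (n·x fix) (≡.subst (λ n → n · x ≈ 0#) (≡.sym n≡k*2) (even·x k x))

  tr-odd : ¬ 2 ∣ n → ∀ {x} → Fixed x → tr x ≈ x
  tr-odd 2∤n {x} fix = trans (n·x fix) (≡.subst (λ n → n · x ≈ x) (≡.sym odd) (trans (+-congˡ (even·x (n / 2) x)) (+-identityʳ x)))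
    where
    odd : n ≡ 1 ℕ.+ n / 2 ℕ.* 2
    odd with n % 2 in eq | ℕ.m%n<n n 2
    ... | 0 | _ = contradiction (m%n≡0⇒n∣m n 2 eq) 2∤n
    ... | 1 | _ = ≡.trans (ℕ.m≡m%n+[m/n]*n n 2) (≡.cong (ℕ._+ n / 2 ℕ.* 2) eq)
    ... | suc (suc _) | s≤s (s≤s ())

  2≤q : 2 ≤ q
  2≤q = ℕ.^-monoʳ-≤ 2 {x = 1} (ℕ.>-nonZero⁻¹ m)

  private
    trace-leading : ∀ k → Leading 1# (q ℕ.^ k) (λ x → sum {suc k} (λ i → x ^ (q ℕ.^ toℕ i)))
    trace-leading zero    = leading-≈ refl (λ x → sym (+-identityʳ _)) (leading-^ 1)
    trace-leading (suc k) = leading-≈ (+-identityˡ 1#) (λ x → sym (sum-snoc (suc k) (λ i → x ^ (q ℕ.^ i))))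
      (leading-+ (leading-raise (ℕ.^-monoʳ-< q 2≤q (ℕ.n<1+n k)) (trace-leading k)) (leading-^ (q ℕ.^ suc k)))

  -- The trace is a polynomial of degree q^(n-1), too small to vanish at all q^n elements.
  tr-≉0 : ∃ λ x → tr x ≉ 0#
  tr-≉0 = non-root 1≉0
    (≡.subst (λ j → Leading 1# (q ℕ.^ (n ∸ 1)) (λ x → sum {j} (λ i → x ^ (q ℕ.^ toℕ i)))) (ℕ.suc-pred n) (trace-leading (n ∸ 1)))
    (ℕ.^-monoʳ-< q 2≤q (ℕ.≤-reflexive (ℕ.suc-pred n)))

  tr-scale : ∀ {t x} → Fixed t → tr x ≉ 0# → ∃ λ c → Fixed c × tr (c * x) ≈ t
  tr-scale {t} {x} fix-t tr≉0 =
    let d , tr*d≈1 = inverse tr≉0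
        fix-td     = fixed-* fix-t (fixed-inverse (tr-fixed x) tr*d≈1)
    in t * d , fix-td , (begin
    tr (t * d * x)     ≈⟨ tr-* fix-td x ⟩
    t * d * tr x       ≈⟨ *-assoc t d _ ⟩
    t * (d * tr x)     ≈⟨ *-congˡ (trans (*-comm d _) tr*d≈1) ⟩
    t * 1#             ≈⟨ *-identityʳ t ⟩
    t                  ∎)

  tr-surjective : ∀ {t} → Fixed t → ∃ λ x → tr x ≈ t
  tr-surjective fix-t = let x , tr≉0 = tr-≉0; c , _ , eq = tr-scale fix-t tr≉0 in c * x , eq

  -- Two K-linear forms Tr(·) and Tr(β·) with the same kernel are proportional over K.
  separate : ∀ {β} → ¬ Fixed β → ∃ λ x → tr x ≉ 0# × tr (β * x) ≈ 0#
  separate {β} β∉K = x , tr-x≉0 , tr-βx≈0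
    where
    β≉0 : β ≉ 0#
    β≉0 β≈0 = β∉K (fixed-≈ (sym β≈0) fixed-0)

    β⁻¹ x₀ c y s x : Carrier
    β⁻¹ = proj₁ (inverse β≉0)
    x₀ = β⁻¹ * proj₁ (tr-surjective fixed-1)
    c = tr x₀

    tr-βx₀≈1 : tr (β * x₀) ≈ 1#
    tr-βx₀≈1 = trans (tr-cong (trans (sym (*-assoc β β⁻¹ _)) (trans (*-congʳ (proj₂ (inverse β≉0))) (*-identityˡ _))))
                     (proj₂ (tr-surjective fixed-1))

    γ≉0 : 1# + c * β ≉ 0#
    γ≉0 eq = β∉K (fixed-inverse (tr-fixed x₀) (sym (x+y≈0⇒x≈y eq)))

    γ⁻¹ : Carrier
    γ⁻¹ = proj₁ (inverse γ≉0)

    -- `x` is the projection of `y` along `x₀` onto the kernel of Tr(β·). Its trace is Tr y + c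
    -- Tr(βy) = Tr(γy) with γ = 1 + cβ, so dividing an element of nonzero trace by γ gives the
    -- required `y`. Here γ ≠ 0, as otherwise β would be inverse to c ∈ K.
    y = γ⁻¹ * proj₁ tr-≉0
    s = tr (β * y)
    x = y + s * x₀

    tr-βx≈0 : tr (β * x) ≈ 0#
    tr-βx≈0 = begin
      tr (β * (y + s * x₀))            ≈⟨ tr-cong (solve 4 (λ b y s x → b :* (y :+ s :* x) := b :* y :+ s :* (b :* x)) refl β y s x₀) ⟩
      tr (β * y + s * (β * x₀))        ≈⟨ tr-+ _ _ ⟩
      s + tr (s * (β * x₀))            ≈⟨ +-congˡ (tr-* (tr-fixed (β * y)) (β * x₀)) ⟩
      s + s * tr (β * x₀)              ≈⟨ +-congˡ (trans (*-congˡ tr-βx₀≈1) (*-identityʳ s)) ⟩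
      s + s                            ≈⟨ x+x≈0 s ⟩
      0#                               ∎

    tr-x≉0 : tr x ≉ 0#
    tr-x≉0 tr-x≈0 = proj₂ tr-≉0 (begin
      tr (proj₁ tr-≉0)                 ≈⟨ tr-cong (sym (trans (sym (*-assoc _ γ⁻¹ _)) (trans (*-congʳ (proj₂ (inverse γ≉0))) (*-identityˡ _)))) ⟩
      tr ((1# + c * β) * y)            ≈⟨ tr-cong (solve 3 (λ c b y → (con 1 :+ c :* b) :* y := y :+ c :* (b :* y)) refl c β y) ⟩
      tr (y + c * (β * y))             ≈⟨ tr-+ _ _ ⟩
      tr y + tr (c * (β * y))          ≈⟨ +-congˡ (tr-* (tr-fixed x₀) (β * y)) ⟩
      tr y + c * s                     ≈⟨ +-congˡ (trans (*-comm c s) (sym (tr-* (tr-fixed (β * y)) x₀))) ⟩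
      tr y + tr (s * x₀)               ≈⟨ sym (tr-+ _ _) ⟩
      tr x                             ≈⟨ tr-x≈0 ⟩
      0#                               ∎)

  -- Injectivity of f.

  module _ (l k : ℕ) (a : Carrier) (a≉0 : a ≉ 0#) where
    r : ℕ
    r = l ℕ.+ m ℕ.* k

    σ f : Carrier → Carrier
    σ x = x ^ (2 ℕ.^ r)
    f x = a * σ x + x * tr x

    σ-fixed : ∀ {x} → Fixed x → σ x ≈ x ^ (2 ℕ.^ l)
    σ-fixed {x} fix = begin
      x ^ (2 ℕ.^ (l ℕ.+ m ℕ.* k))              ≈⟨ sym (frobenius-∘ l (m ℕ.* k) x) ⟩
      (x ^ (2 ℕ.^ l)) ^ (2 ℕ.^ (m ℕ.* k))      ≡⟨ ≡.cong ((x ^ (2 ℕ.^ l)) ^_) (≡.sym (ℕ.^-*-assoc 2 m k)) ⟩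
      (x ^ (2 ℕ.^ l)) ^ (q ℕ.^ k)              ≈⟨ ^-swap x (2 ℕ.^ l) (q ℕ.^ k) ⟩
      (x ^ (q ℕ.^ k)) ^ (2 ℕ.^ l)              ≈⟨ ^-congˡ (2 ℕ.^ l) (fixed-iterate k fix) ⟩
      x ^ (2 ℕ.^ l)                            ∎

    f-cong : Congruent _≈_ _≈_ f
    f-cong x≈y = +-cong (*-congˡ (^-congˡ (2 ℕ.^ r) x≈y)) (*-cong x≈y (tr-cong x≈y))

    f-0 : f 0# ≈ 0#
    f-0 = trans (+-cong (trans (*-congˡ (frobenius-0 r)) (zeroʳ a)) (zeroˡ _)) (+-identityʳ 0#)

    -- f(x + y) differs from f x by y (ac + Tr x), which vanishes once x is chosen with trace ac.
    collision : Injective _≈_ _≈_ f → ∀ {c y} → Fixed (a * c) → σ y ≈ c * y → tr y ≈ 0# → y ≈ 0#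
    collision f-inj {c} {y} fix-ac σy≈cy tr-y≈0 = +-cancelˡ x _ _ (trans (f-inj fx+y≈fx) (sym (+-identityʳ x)))
      where
      x : Carrier
      x = proj₁ (tr-surjective fix-ac)

      fx+y≈fx : f (x + y) ≈ f x
      fx+y≈fx = begin
        a * σ (x + y) + (x + y) * tr (x + y)      ≈⟨ +-cong (*-congˡ (trans (frobenius-+ r x y) (+-congˡ σy≈cy)))
                                                        (*-congˡ (trans (tr-+ x y) (trans (+-congˡ tr-y≈0) (+-identityʳ _)))) ⟩
        a * (σ x + c * y) + (x + y) * tr x        ≈⟨ solve 6 (λ a s c x y t → a :* (s :+ c :* y) :+ (x :+ y) :* t
                                                        := (a :* s :+ x :* t) :+ (a :* c :* y :+ y :* t)) refl a (σ x) c x y (tr x) ⟩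
        f x + (a * c * y + y * tr x)              ≈⟨ +-congˡ (x≈y⇒x+y≈0 (trans (*-comm _ y) (*-congˡ (sym (proj₂ (tr-surjective fix-ac)))))) ⟩
        f x + 0#                                  ≈⟨ +-identityʳ _ ⟩
        f x                                       ∎

    injective⇒fixed : Injective _≈_ _≈_ f → Fixed a
    injective⇒fixed f-inj with a ^ q ≈? a
    ... | yes fix = fix
    ... | no  a∉K = contradiction (trans (sym tr-x₁≈1) (trans (tr-cong (f-inj fx₁≈fx₂)) tr-x₂≈0)) 1≉0
      where
      b c x₁ z x₂ : Carrier
      b = proj₁ (inverse a≉0)

      b+1∉K : ¬ Fixed (b + 1#)
      b+1∉K fix = a∉K (fixed-inverse (fixed-≈ (+-cancel-middle b 1#) (fixed-+ fix fixed-1))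
                                     (trans (*-comm b a) (proj₂ (inverse a≉0))))

      x₀ : Carrier
      -- Tr((b + 1)x₀) = 0 makes Tr(b x₀) and Tr x₀ equal and nonzero; one factor from K then scales
      -- both to 1.
      x₀ = proj₁ (separate b+1∉K)

      scaled : ∃ λ c → Fixed c × tr (c * x₀) ≈ 1#
      scaled = tr-scale fixed-1 (proj₁ (proj₂ (separate b+1∉K)))

      c = proj₁ scaled
      x₁ = c * x₀

      tr-x₁≈1 : tr x₁ ≈ 1#
      tr-x₁≈1 = proj₂ (proj₂ scaled)

      tr-bx₁≈1 : tr (b * x₁) ≈ 1#
      tr-bx₁≈1 = trans (x+y≈0⇒x≈y (begin
        tr (b * x₁) + tr x₁       ≈⟨ sym (tr-+ _ _) ⟩
        tr (b * x₁ + x₁)          ≈⟨ tr-cong (solve 3 (λ b c x → b :* (c :* x) :+ c :* x := c :* ((b :+ con 1) :* x)) refl b c x₀) ⟩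
        tr (c * ((b + 1#) * x₀))  ≈⟨ tr-* (proj₁ (proj₂ scaled)) _ ⟩
        c * tr ((b + 1#) * x₀)    ≈⟨ *-congˡ (proj₂ (proj₂ (separate b+1∉K))) ⟩
        c * 0#                    ≈⟨ zeroʳ c ⟩
        0#                        ∎)) tr-x₁≈1

      -- This is b f(x₁), since Tr x₁ = 1 and ab = 1.
      z = σ x₁ + b * x₁
      x₂ = proj₁ (frobenius-surjective r z)

      σx₂≈z : σ x₂ ≈ z
      σx₂≈z = proj₂ (frobenius-surjective r z)

      tr-x₂≈0 : tr x₂ ≈ 0#
      tr-x₂≈0 = x^k≈0⇒x≈0 (2 ℕ.^ r) (begin
        σ (tr x₂)                 ≈⟨ sym (tr-frobenius r x₂) ⟩
        tr (σ x₂)                 ≈⟨ tr-cong σx₂≈z ⟩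
        tr (σ x₁ + b * x₁)        ≈⟨ tr-+ _ _ ⟩
        tr (σ x₁) + tr (b * x₁)   ≈⟨ +-cong (tr-frobenius r x₁) tr-bx₁≈1 ⟩
        σ (tr x₁) + 1#            ≈⟨ +-congʳ (trans (^-congˡ (2 ℕ.^ r) tr-x₁≈1) (1^k≈1 (2 ℕ.^ r))) ⟩
        1# + 1#                   ≈⟨ 1+1≈0 ⟩
        0#                        ∎)

      fx₁≈fx₂ : f x₁ ≈ f x₂
      fx₁≈fx₂ = begin
        a * σ x₁ + x₁ * tr x₁     ≈⟨ +-congˡ (trans (*-congˡ tr-x₁≈1) (*-comm x₁ 1#)) ⟩
        a * σ x₁ + 1# * x₁        ≈⟨ +-congˡ (*-congʳ (sym (proj₂ (inverse a≉0)))) ⟩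
        a * σ x₁ + a * b * x₁     ≈⟨ solve 4 (λ a s b x → a :* s :+ a :* b :* x := a :* (s :+ b :* x)) refl a (σ x₁) b x₁ ⟩
        a * z                     ≈⟨ *-congˡ (sym σx₂≈z) ⟩
        a * σ x₂                  ≈⟨ sym (+-identityʳ _) ⟩
        a * σ x₂ + 0#             ≈⟨ +-congˡ (sym (trans (*-congˡ tr-x₂≈0) (zeroʳ x₂))) ⟩
        a * σ x₂ + x₂ * tr x₂     ∎

    injective⇒odd : Injective _≈_ _≈_ f → Fixed a → ¬ 2 ∣ n
    injective⇒odd f-inj fix-a 2∣n = 1≉0 (collision f-inj (fixed-≈ (sym (*-identityʳ a)) fix-a)
      (trans (1^k≈1 (2 ℕ.^ r)) (sym (*-identityˡ 1#))) (tr-even 2∣n fixed-1))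

    -- `M` stands for (q^n - 1)/(q - 1), given by its product with q - 1 to keep integer division
    -- out of the exponents.
    module _ (M : ℕ) (M[q∸1]≡q^n∸1 : M ℕ.* (q ∸ 1) ≡ q ℕ.^ n ∸ 1) where
      private
        s = 2 ℕ.^ r ∸ 1

        M[q∸1]≢0 : NonZero (M ℕ.* (q ∸ 1))
        M[q∸1]≢0 = ≡.subst NonZero (≡.sym (≡.trans M[q∸1]≡q^n∸1 (≡.cong (_∸ 1) (ℕ.^-*-assoc 2 m n))))
                     (2^m∸1≢0 (m ℕ.* n) {{ℕ.m*n≢0 m n}})

        M≢0 : NonZero M
        M≢0 = ℕ.m*n≢0⇒m≢0 M {{M[q∸1]≢0}}

      -- If g = gcd(s, M) > 1, the (M/g)-th powers contain a y outside K with y^s in K. For y =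
      -- w^(M/g), y^(q-1) = w^D with D = (q^n - 1)/g, while y^(s(q-1)) is a power of w^(q^n - 1) =
      -- 1. Then `collision` applied to y + Tr y forces y = Tr y ∈ K.
      injective⇒coprime : Injective _≈_ _≈_ f → Fixed a → ¬ 2 ∣ n → gcd s M ≡ 1
      injective⇒coprime f-inj fix-a 2∤n with gcd s M ℕ.≟ 1
      ... | yes eq = eq
      ... | no neq = contradiction (fixed-≈ (sym (x+y≈0⇒x≈y y+tr-y≈0)) (tr-fixed y)) y∉K
        where
        g h s′ D : ℕ
        g = gcd s M
        h = _∣_.quotient (gcd[m,n]∣n s M)
        s′ = _∣_.quotient (gcd[m,n]∣m s M)
        D = h ℕ.* (q ∸ 1)

        M≡hg : M ≡ h ℕ.* g
        M≡hg = _∣_.equality (gcd[m,n]∣n s M)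

        s≡s′g : s ≡ s′ ℕ.* g
        s≡s′g = _∣_.equality (gcd[m,n]∣m s M)

        Dg≡q^n∸1 : D ℕ.* g ≡ q ℕ.^ n ∸ 1
        Dg≡q^n∸1 = ≡.trans (rearrange h (q ∸ 1) g) (≡.trans (≡.cong (ℕ._* (q ∸ 1)) (≡.sym M≡hg)) M[q∸1]≡q^n∸1)
          where
          rearrange : ∀ h p g → h ℕ.* p ℕ.* g ≡ h ℕ.* g ℕ.* p
          rearrange = solve-∀

        Dg≢0 : NonZero (D ℕ.* g)
        Dg≢0 = ≡.subst NonZero (≡.trans M[q∸1]≡q^n∸1 (≡.sym Dg≡q^n∸1)) M[q∸1]≢0

        D≢0 : NonZero D
        D≢0 = ℕ.m*n≢0⇒m≢0 D {{Dg≢0}}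

        1<g : 1 < g
        1<g = ℕ.≤∧≢⇒< (ℕ.>-nonZero⁻¹ g {{ℕ.m*n≢0⇒n≢0 D {{Dg≢0}}}}) (neq ∘ ≡.sym)

        1+D<q^n : suc D < q ℕ.^ n
        1+D<q^n = ≡.subst (suc D <_) (≡.trans (≡.cong suc Dg≡q^n∸1) (suc[b^k∸1]≡b^k q n))
                    (s≤s (ℕ.m<m*n D g {{D≢0}} 1<g))

        -- X(X^D + 1) has degree D + 1 < q^n because g > 1. At a non-root both factors are nonzero,
        -- that is, w ≠ 0 and w^D ≠ 1.
        root-free : ∃ λ w → w * (w ^ D + 1#) ≉ 0#
        root-free = non-root (1≉0 ∘ trans (sym (+-identityʳ 1#)))
          (leading-shift (leading-+ (leading-^ D) (leading-raise (ℕ.>-nonZero⁻¹ D {{D≢0}}) (constant {u = 1#} (λ _ → refl)))))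
          1+D<q^n

        w y κ : Carrier
        w = proj₁ root-free
        y = w ^ h
        κ = y ^ s

        w≉0 : w ≉ 0#
        w≉0 = factor-≉0ˡ (proj₂ root-free)

        y∉K : ¬ Fixed y
        y∉K fix = factor-≉0ʳ (proj₂ root-free) (x≈y⇒x+y≈0 (trans (sym (^-assocʳ w h (q ∸ 1)))
          (x^k≈x⇒x^[k∸1]≈1 q (^-≉0 h w≉0) fix)))

        fix-κ : Fixed κ
        fix-κ = x^[k∸1]≈1⇒x^k≈x q (begin
          κ ^ (q ∸ 1)                             ≈⟨ ^-assocʳ y s (q ∸ 1) ⟩
          y ^ (s ℕ.* (q ∸ 1))                     ≈⟨ ^-assocʳ w h (s ℕ.* (q ∸ 1)) ⟩
          w ^ (h ℕ.* (s ℕ.* (q ∸ 1)))             ≡⟨ ≡.cong (w ^_) exponent ⟩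
          w ^ ((q ℕ.^ n ∸ 1) ℕ.* s′)              ≈⟨ x^i≈1⇒x^[i*j]≈1 (q ℕ.^ n ∸ 1) s′ (x^[N∸1]≈1 w≉0) ⟩
          1#                                      ∎)
          where
          rearrange : ∀ h p g s → h ℕ.* (s ℕ.* g ℕ.* p) ≡ h ℕ.* p ℕ.* g ℕ.* s
          rearrange = solve-∀
          exponent : h ℕ.* (s ℕ.* (q ∸ 1)) ≡ (q ℕ.^ n ∸ 1) ℕ.* s′
          exponent = ≡.trans (≡.cong (λ s → h ℕ.* (s ℕ.* (q ∸ 1))) s≡s′g)
                       (≡.trans (rearrange h (q ∸ 1) g s′) (≡.cong (ℕ._* s′) Dg≡q^n∸1))

        σy≈κy : σ y ≈ κ * y
        σy≈κy = trans (^-congʳ y (≡.sym (suc[b^k∸1]≡b^k 2 r))) (*-comm y κ)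

        σtr-y≈κtr-y : σ (tr y) ≈ κ * tr y
        σtr-y≈κtr-y = trans (sym (tr-frobenius r y)) (trans (tr-cong σy≈κy) (tr-* fix-κ y))

        y+tr-y≈0 : y + tr y ≈ 0#
        y+tr-y≈0 = collision f-inj (fixed-* fix-a fix-κ)
          (trans (frobenius-+ r y (tr y)) (trans (+-cong σy≈κy σtr-y≈κtr-y) (sym (distribˡ κ y (tr y)))))
          (trans (tr-+ y (tr y)) (x≈y⇒x+y≈0 (sym (tr-odd 2∤n (tr-fixed y)))))

      -- The power q - 1 turns elements of K* into 1, so u = z^(q-1) satisfies σ u = u, that is u^s
      -- = 1. Also u^M = z^(q^n - 1) = 1, and coprimality leaves u = 1.
      coprime⇒fixed : gcd s M ≡ 1 → Fixed a → ∀ {κ z} → Fixed κ → a * σ z ≈ κ * z → z ≉ 0# → Fixed z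
      coprime⇒fixed coprime fix-a {κ} {z} fix-κ aσz≈κz z≉0 = x^[k∸1]≈1⇒x^k≈x q
        (coprime-exponents s M {{M≢0}} coprime
          (x^k≈x⇒x^[k∸1]≈1 (2 ℕ.^ r) (^-≉0 (q ∸ 1) z≉0) σu≈u)
          (trans (^-assocʳ z (q ∸ 1) M) (trans (^-congʳ z (≡.trans (ℕ.*-comm (q ∸ 1) M) M[q∸1]≡q^n∸1)) (x^[N∸1]≈1 z≉0))))
        where
        κ≉0 : κ ≉ 0#
        κ≉0 = factor-≉0ˡ (*-≉0 a≉0 (^-≉0 (2 ℕ.^ r) z≉0) ∘ trans aσz≈κz)

        absorb : ∀ {b} x → Fixed b → b ≉ 0# → (b * x) ^ (q ∸ 1) ≈ x ^ (q ∸ 1)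
        absorb {b} x fix b≉0 = trans (^-distrib-* b x (q ∸ 1)) (trans (*-congʳ (x^k≈x⇒x^[k∸1]≈1 q b≉0 fix)) (*-identityˡ _))

        σu≈u : σ (z ^ (q ∸ 1)) ≈ z ^ (q ∸ 1)
        σu≈u = begin
          σ (z ^ (q ∸ 1))        ≈⟨ ^-swap z (q ∸ 1) (2 ℕ.^ r) ⟩
          σ z ^ (q ∸ 1)          ≈⟨ sym (absorb (σ z) fix-a a≉0) ⟩
          (a * σ z) ^ (q ∸ 1)    ≈⟨ ^-congˡ (q ∸ 1) aσz≈κz ⟩
          (κ * z) ^ (q ∸ 1)      ≈⟨ absorb z fix-κ κ≉0 ⟩
          z ^ (q ∸ 1)            ∎

      coprime⇒injective : gcd s M ≡ 1 → Fixed a → ¬ 2 ∣ n → (∀ {t} → Fixed t → a * t ^ (2 ℕ.^ l) ≈ t ^ 2 → t ≈ 0#) →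
                          Injective _≈_ _≈_ f
      coprime⇒injective coprime fix-a 2∤n kernel {x} {y} fx≈fy with x + y ≈? 0#
      ... | yes x+y≈0 = x+y≈0⇒x≈y x+y≈0
      ... | no  z≉0   = contradiction (trans (sym (tr-odd 2∤n fix-z)) tr-z≈0) z≉0
        where
        z : Carrier
        z = x + y

        G : Carrier → Carrier
        G t = a * t ^ (2 ℕ.^ l) + t ^ 2

        tr-f : ∀ x → tr (f x) ≈ G (tr x)
        tr-f x = begin
          tr (a * σ x + x * tr x)                   ≈⟨ tr-+ _ _ ⟩
          tr (a * σ x) + tr (x * tr x)              ≈⟨ +-cong (tr-* fix-a (σ x)) (trans (tr-cong (*-comm x (tr x))) (tr-* (tr-fixed x) x)) ⟩
          a * tr (σ x) + tr x * tr x                ≈⟨ +-cong (*-congˡ (trans (tr-frobenius r x) (σ-fixed (tr-fixed x)))) (*-congˡ (sym (*-identityʳ _))) ⟩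
          a * tr x ^ (2 ℕ.^ l) + tr x ^ 2           ∎

        G-+ : ∀ s t → G (s + t) ≈ G s + G t
        G-+ s t = begin
          a * (s + t) ^ (2 ℕ.^ l) + (s + t) ^ 2     ≈⟨ +-cong (*-congˡ (frobenius-+ l s t)) (frobenius-+ 1 s t) ⟩
          a * (s ^ (2 ℕ.^ l) + t ^ (2 ℕ.^ l)) + (s ^ 2 + t ^ 2)
            ≈⟨ solve 5 (λ a s t u v → a :* (s :+ t) :+ (u :+ v) := (a :* s :+ u) :+ (a :* t :+ v)) refl a (s ^ (2 ℕ.^ l)) (t ^ (2 ℕ.^ l)) (s ^ 2) (t ^ 2) ⟩
          G s + G t                                 ∎

        tr-z≈0 : tr z ≈ 0#
        tr-z≈0 = trans (tr-+ x y) (kernel (fixed-+ (tr-fixed x) (tr-fixed y)) (x+y≈0⇒x≈y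
          (trans (G-+ (tr x) (tr y)) (x≈y⇒x+y≈0 (trans (sym (tr-f x)) (trans (tr-cong fx≈fy) (tr-f y)))))))

        -- With equal traces, the difference of f x and f y depends on x and y only through z and
        -- the common value Tr x.
        aσz≈κz : a * σ z ≈ tr x * z
        aσz≈κz = x+y≈0⇒x≈y (begin
          a * σ (x + y) + tr x * (x + y)            ≈⟨ +-congʳ (*-congˡ (frobenius-+ r x y)) ⟩
          a * (σ x + σ y) + tr x * (x + y)          ≈⟨ solve 6 (λ a s u t x y → a :* (s :+ u) :+ t :* (x :+ y)
                                                          := (a :* s :+ x :* t) :+ (a :* u :+ y :* t)) refl a (σ x) (σ y) (tr x) x y ⟩
          f x + (a * σ y + y * tr x)                ≈⟨ +-congˡ (+-congˡ (*-congˡ (x+y≈0⇒x≈y (trans (sym (tr-+ x y)) tr-z≈0)))) ⟩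
          f x + f y                                 ≈⟨ x≈y⇒x+y≈0 fx≈fy ⟩
          0#                                        ∎)

        fix-z : Fixed z
        fix-z = coprime⇒fixed coprime fix-a (tr-fixed x) aσz≈κz z≉0

    -- For odd n the trace is the identity on K, so f restricts there to t ↦ a t^(2^l) + t^2, and a
    -- root t satisfies f t = 0 = f 0.
    injective⇒kernel : Injective _≈_ _≈_ f → ¬ 2 ∣ n → ∀ {t} → Fixed t → a * t ^ (2 ℕ.^ l) ≈ t ^ 2 → t ≈ 0#
    injective⇒kernel f-inj 2∤n {t} fix at^≈t² = f-inj (trans (begin
      a * σ t + t * tr t               ≈⟨ +-cong (*-congˡ (σ-fixed fix)) (*-congˡ (trans (tr-odd 2∤n fix) (sym (*-identityʳ t)))) ⟩
      a * t ^ (2 ℕ.^ l) + t ^ 2        ≈⟨ x≈y⇒x+y≈0 at^≈t² ⟩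
      0#                               ∎) (sym f-0))

-- Evaluation of coefficient lists.

module Evaluation {c ℓ N} (L : FiniteField c ℓ N) where
  open FiniteField L hiding (zero; _-_)
  open Polynomials L
  open CommutativeRing commutativeRing using (setoid)
  open import Algebra.Properties.CommutativeMonoid.Sum +-commutativeMonoid using (sum)
  open import Algebra.Solver.Ring.NaturalCoefficients.Default commutativeSemiring
  open import Relation.Binary.Reasoning.Setoid setoid

  eval-⊕ : ∀ f g x → eval (f ⊕ g) x ≈ eval f x + eval g x
  eval-⊕ []      g       x = sym (+-identityˡ _)
  eval-⊕ (a ∷ f) []      x = sym (+-identityʳ _)
  eval-⊕ (a ∷ f) (b ∷ g) x = trans (+-congˡ (*-congˡ (eval-⊕ f g x)))
    (solve 5 (λ a b x u v → (a :+ b) :+ x :* (u :+ v) := (a :+ x :* u) :+ (b :+ x :* v)) refl a b x (eval f x) (eval g x))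

  eval-map-* : ∀ a f x → eval (map (a *_) f) x ≈ a * eval f x
  eval-map-* a []      x = sym (zeroʳ a)
  eval-map-* a (b ∷ f) x = trans (+-congˡ (*-congˡ (eval-map-* a f x)))
    (solve 4 (λ a b x u → a :* b :+ x :* (a :* u) := a :* (b :+ x :* u)) refl a b x (eval f x))

  eval-⊗ : ∀ f g x → eval (f ⊗ g) x ≈ eval f x * eval g x
  eval-⊗ []      g x = sym (zeroˡ _)
  eval-⊗ (a ∷ f) g x = begin
    eval (map (a *_) g ⊕ (0# ∷ f ⊗ g)) x               ≈⟨ eval-⊕ (map (a *_) g) (0# ∷ f ⊗ g) x ⟩
    eval (map (a *_) g) x + (0# + x * eval (f ⊗ g) x)  ≈⟨ +-cong (eval-map-* a g x) (+-congˡ (*-congˡ (eval-⊗ f g x))) ⟩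
    a * eval g x + (0# + x * (eval f x * eval g x))    ≈⟨ solve 4 (λ a u x v → a :* v :+ (con 0 :+ x :* (u :* v)) := (a :+ x :* u) :* v) refl a (eval f x) x (eval g x) ⟩
    (a + x * eval f x) * eval g x                      ∎

  eval-C : ∀ a x → eval (C a) x ≈ a
  eval-C a x = trans (+-congˡ (zeroʳ x)) (+-identityʳ a)

  eval-X^ : ∀ e x → eval (X^ e) x ≈ x ^ e
  eval-X^ zero    x = eval-C 1# x
  eval-X^ (suc e) x = trans (+-identityˡ _) (*-congˡ (eval-X^ e x))

  eval-sum-X^ : ∀ n (h : ℕ → ℕ) x → eval (foldr _⊕_ [] (applyUpTo (λ i → X^ h i) n)) x ≈ sum {n} (λ i → x ^ h (toℕ i))
  eval-sum-X^ zero    h x = refl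
  eval-sum-X^ (suc n) h x = trans (eval-⊕ (X^ h 0) _ x) (+-cong (eval-X^ (h 0) x) (eval-sum-X^ n (h ∘ suc) x))

-- The image of K in L as the solution set of x^q = x.

module Subfield {c ℓ c′ ℓ′ q Q} {K : FiniteField c ℓ q} {L : FiniteField c′ ℓ′ Q} (K⊆L : Embedding K L) where
  open Embedding K⊆L
  private
    module K where
      open FiniteField K public
      open FiniteFieldProperties K public
    module L where
      open FiniteField L public hiding (zero)
      open FiniteFieldProperties L public
  open RingMorphisms.IsRingMonomorphism isRingMonomorphism public
    using (⟦⟧-cong; *-homo; 0#-homo; 1#-homo; injective)

  ι-^ : ∀ x k → ι (x K.^ k) L.≈ ι x L.^ k
  ι-^ x zero    = 1#-homo
  ι-^ x (suc k) = L.trans (*-homo x (x K.^ k)) (L.*-congˡ (ι-^ x k))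

  ι-≉0 : ∀ {x} → x K.≉ K.0# → ι x L.≉ L.0#
  ι-≉0 x≉0 ιx≈0 = x≉0 (injective (L.trans ιx≈0 (L.sym 0#-homo)))

  ≉0-ι : ∀ {x} → ι x L.≉ L.0# → x K.≉ K.0#
  ≉0-ι ιx≉0 x≈0 = ιx≉0 (L.trans (⟦⟧-cong x≈0) 0#-homo)

  ∈K⇒x^q≈x : ∀ {x} → x ∈K → x L.^ q L.≈ x
  ∈K⇒x^q≈x (y , ιy≈x) = L.trans (L.^-congˡ q (L.sym ιy≈x))
    (L.trans (L.sym (ι-^ y q)) (L.trans (⟦⟧-cong (K.x^N≈x y)) ιy≈x))

  -- A further solution, together with the q images of elements of K, would give q + 1 roots of X^q
  -- + X. The sign is that of characteristic two, and 1 < q keeps the leading coefficient nonzero.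
  x^q≈x⇒∈K : (∀ x → x L.+ x L.≈ L.0#) → 1 ℕ.< q → ∀ {x} → x L.^ q L.≈ x → x ∈K
  x^q≈x⇒∈K x+x≈0 1<q {x} x^q≈x with Fin.any? (λ i → ι (K.element i) L.≈? x)
  ... | yes (i , eq) = K.element i , eq
  ... | no  x∉K      = contradiction (L.root-bound u≉0 lead roots roots-injective are-roots) ℕ.1+n≰n
    where
    lead : L.Leading (L.1# L.+ L.0#) q (λ x → x L.^ q L.+ x L.^ 1)
    lead = L.leading-+ (L.leading-^ q) (L.leading-raise 1<q (L.leading-^ 1))

    u≉0 : L.1# L.+ L.0# L.≉ L.0#
    u≉0 = L.1≉0 ∘ L.trans (L.sym (L.+-identityʳ L.1#))

    roots : Fin (suc q) → L.Carrier
    roots zero    = x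
    roots (suc i) = ι (K.element i)

    roots-injective : Injective _≡_ L._≈_ roots
    roots-injective {zero}  {zero}  eq = ≡.refl
    roots-injective {zero}  {suc j} eq = contradiction (j , L.sym eq) x∉K
    roots-injective {suc i} {zero}  eq = contradiction (i , eq) x∉K
    roots-injective {suc i} {suc j} eq = ≡.cong suc (K.element-injective (injective eq))

    root : ∀ {x} → x L.^ q L.≈ x → x L.^ q L.+ x L.^ 1 L.≈ L.0#
    root {x} eq = L.trans (L.+-cong eq (L.*-identityʳ x)) (x+x≈0 x)

    are-roots : ∀ i → roots i L.^ q L.+ roots i L.^ 1 L.≈ L.0#
    are-roots zero    = root x^q≈x
    are-roots (suc i) = root (∈K⇒x^q≈x (K.element i , L.refl))

-- Transfer of the kernel condition between K and L, and the equivalence.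

open import Data.Nat.Base using (_+_; _*_; _^_)

corollary15 :
    ∀ {c ℓ c′ ℓ′}
    (m n k l : ℕ) .{{_ : NonZero m}} .{{_ : NonZero n}} →
    let q = 2 ^ m
        d = gcd ∣ + l - + 1 ∣ m
        instance
          q∸1≢0 = 2^m∸1≢0 m
          2^d∸1≢0 = 2^gcd∸1≢0 ∣ + l - + 1 ∣ m
    in
    (K : FiniteField c ℓ q) (L : FiniteField c′ ℓ′ (q ^ n)) (K⊆L : Embedding K L) →
    let module L = FiniteField L
        open Polynomials L
        open Embedding K⊆L using (_∈K*)
    in
    (a : L.Carrier) → ¬ a L.≈ L.0# →
    IsPermutationPolynomial (C a ⊗ X^ (2 ^ l * q ^ k) ⊕ X ⊗ Tr q n)
      ⇔
    ( ¬ 2 ∣ n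
    × gcd (2 ^ (l + m * k) ∸ 1) ((q ^ n ∸ 1) / (q ∸ 1)) ≡ 1
    × a ∈K*
    × ¬ a L.^ ((q ∸ 1) / (2 ^ d ∸ 1)) L.≈ L.1# )
corollary15 m n k l K L K⊆L a a≉0 = mk⇔ necessity sufficiency
  where
  open Embedding K⊆L using (ι; _∈K; _∈K*)
  open Polynomials L
  open Subfield K⊆L
  open Evaluation L
  module K where
    open FiniteField K public
    open FiniteFieldProperties K public
    open CharacteristicTwo K m ≡.refl public
  module L where
    open CharacteristicTwo L (m * n) (ℕ.^-*-assoc 2 m n) public
    open FiniteField L public hiding (zero)
    open FiniteFieldProperties L public
    open TracePermutation m n L public

  instance
    q∸1≢0 : NonZero (2 ^ m ∸ 1)
    q∸1≢0 = 2^m∸1≢0 m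
    2^d∸1≢0 : NonZero (2 ^ gcd ∣ + l - + 1 ∣ m ∸ 1)
    2^d∸1≢0 = 2^gcd∸1≢0 ∣ + l - + 1 ∣ m

  q M E : ℕ
  q = 2 ^ m
  M = (q ^ n ∸ 1) / (q ∸ 1)
  E = (q ∸ 1) / (2 ^ gcd ∣ + l - + 1 ∣ m ∸ 1)

  M[q∸1]≡q^n∸1 : M * (q ∸ 1) ≡ q ^ n ∸ 1
  M[q∸1]≡q^n∸1 = ℕ.m/n*n≡m (b∸1∣b^k∸1 q n {{ℕ.m^n≢0 2 m}})

  p : Polynomial
  p = C a ⊗ X^ (2 ^ l * q ^ k) ⊕ X ⊗ Tr q n

  f : L.Carrier → L.Carrier
  f = L.f l k a a≉0

  eval-p : ∀ x → eval p x L.≈ f x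
  eval-p x = L.trans (eval-⊕ (C a ⊗ X^ (2 ^ l * q ^ k)) (X ⊗ Tr q n) x) (L.+-cong
    (L.trans (eval-⊗ (C a) (X^ (2 ^ l * q ^ k)) x)
      (L.*-cong (eval-C a x) (L.trans (eval-X^ (2 ^ l * q ^ k) x) (L.^-congʳ x exponent))))
    (L.trans (eval-⊗ X (Tr q n) x) (L.*-cong (L.trans (eval-X^ 1 x) (L.*-identityʳ x)) (eval-sum-X^ n (q ^_) x))))
    where
    exponent : 2 ^ l * q ^ k ≡ 2 ^ (l + m * k)
    exponent = ≡.trans (≡.cong (2 ^ l *_) (ℕ.^-*-assoc 2 m k)) (≡.sym (ℕ.^-distribˡ-+-* 2 l (m * k)))

  fixed⇒∈K : ∀ {x} → L.Fixed x → x ∈K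
  fixed⇒∈K = x^q≈x⇒∈K L.x+x≈0 L.2≤q

  module _ (a′ : K.Carrier) (ιa′≈a : ι a′ L.≈ a) where
    a′≉0 : a′ K.≉ K.0#
    a′≉0 = ≉0-ι (λ ιa′≈0 → a≉0 (L.trans (L.sym ιa′≈a) ιa′≈0))

    ι-kernel : ∀ u → ι (a′ K.* u K.^ (2 ^ l)) L.≈ a L.* ι u L.^ (2 ^ l)
    ι-kernel u = L.trans (*-homo a′ _) (L.*-cong ιa′≈a (ι-^ u (2 ^ l)))

    ι-a^E : ι (a′ K.^ E) L.≈ a L.^ E
    ι-a^E = L.trans (ι-^ a′ E) (L.^-congˡ E ιa′≈a)

    -- The exponent `E` comes from the order of K, so the criterion is applied to the preimage a′ in
    -- K and its root is carried to L by ι.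
    a^E≈1⇒kernel : a L.^ E L.≈ L.1# → ∃ λ t → t L.≉ L.0# × L.Fixed t × a L.* t L.^ (2 ^ l) L.≈ t L.^ 2
    a^E≈1⇒kernel a^E≈1 =
      let u , u≉0 , eq = Equivalence.to (K.a^E≈1⇔kernel a′≉0 l) (injective (L.trans ι-a^E (L.trans a^E≈1 (L.sym 1#-homo))))
      in ι u , ι-≉0 u≉0 , ∈K⇒x^q≈x (u , L.refl) , L.trans (L.sym (ι-kernel u)) (L.trans (⟦⟧-cong eq) (ι-^ u 2))

    kernel⇒a^E≈1 : ∀ {t} → t L.≉ L.0# → L.Fixed t → a L.* t L.^ (2 ^ l) L.≈ t L.^ 2 → a L.^ E L.≈ L.1#
    kernel⇒a^E≈1 {t} t≉0 fix eq =
      let u , ιu≈t = fixed⇒∈K fix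
          u≉0 = ≉0-ι (λ ιu≈0 → t≉0 (L.trans (L.sym ιu≈t) ιu≈0))
          a′u^≈u² = injective (L.trans (ι-kernel u) (L.trans (L.*-congˡ (L.^-congˡ (2 ^ l) ιu≈t))
                      (L.trans eq (L.sym (L.trans (ι-^ u 2) (L.^-congˡ 2 ιu≈t))))))
      in L.trans (L.sym ι-a^E) (L.trans (⟦⟧-cong (Equivalence.from (K.a^E≈1⇔kernel a′≉0 l) (u , u≉0 , a′u^≈u²))) 1#-homo)

  necessity : IsPermutationPolynomial p → ¬ 2 ∣ n × gcd (2 ^ (l + m * k) ∸ 1) M ≡ 1 × a ∈K* × ¬ a L.^ E L.≈ L.1#
  necessity (p-inj , _) = 2∤n , L.injective⇒coprime l k a a≉0 M M[q∸1]≡q^n∸1 f-inj fix-a 2∤n , (a∈K , a≉0) , a^E≉1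
    where
    f-inj : Injective L._≈_ L._≈_ f
    f-inj {x} {y} eq = p-inj (L.trans (eval-p x) (L.trans eq (L.sym (eval-p y))))

    fix-a : L.Fixed a
    fix-a = L.injective⇒fixed l k a a≉0 f-inj

    a∈K : a ∈K
    a∈K = fixed⇒∈K fix-a

    2∤n : ¬ 2 ∣ n
    2∤n = L.injective⇒odd l k a a≉0 f-inj fix-a

    a^E≉1 : ¬ a L.^ E L.≈ L.1#
    a^E≉1 a^E≈1 =
      let t , t≉0 , fix-t , eq = a^E≈1⇒kernel (proj₁ a∈K) (proj₂ a∈K) a^E≈1
      in t≉0 (L.injective⇒kernel l k a a≉0 f-inj 2∤n fix-t eq)

  sufficiency : ¬ 2 ∣ n × gcd (2 ^ (l + m * k) ∸ 1) M ≡ 1 × a ∈K* × ¬ a L.^ E L.≈ L.1# → IsPermutationPolynomial p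
  sufficiency (2∤n , coprime , (a∈K , _) , a^E≉1) = p-inj , L.injective⇒surjective p-cong p-inj
    where
    trivial-kernel : ∀ {t} → L.Fixed t → a L.* t L.^ (2 ^ l) L.≈ t L.^ 2 → t L.≈ L.0#
    trivial-kernel {t} fix-t eq with t L.≈? L.0#
    ... | yes t≈0 = t≈0
    ... | no  t≉0 = contradiction (kernel⇒a^E≈1 (proj₁ a∈K) (proj₂ a∈K) t≉0 fix-t eq) a^E≉1

    p-cong : ∀ {x y} → x L.≈ y → eval p x L.≈ eval p y
    p-cong {x} {y} x≈y = L.trans (eval-p x) (L.trans (L.f-cong l k a a≉0 x≈y) (L.sym (eval-p y)))

    p-inj : Injective L._≈_ L._≈_ (eval p)
    p-inj {x} {y} eq = L.coprime⇒injective l k a a≉0 M M[q∸1]≡q^n∸1 coprime (∈K⇒x^q≈x a∈K) 2∤n trivial-kernel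
      (L.trans (L.sym (eval-p x)) (L.trans eq (eval-p y)))
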